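{- Up to permuting the indices $1,2,3$, there are exactly three codes $\mathcal{C}\subseteq 2^{\{1,2,3\}}$ that are convex but not box-convex, namely $$\mathcal{C}_1 = \{123, 12, 13, 23, \emptyset\},$$ $$\mathcal{C}_2 = \{123, 12, 13, 23, 1, \emptyset\},$$ $$\mathcal{C}_3 = \{12, 13, 23, 1, 2, 3, \emptyset\}.$$ That is, each of $\mathcal{C}_1,\mathcal{C}_2,\mathcal{C}_3$ is convex and not box-convex, and every convex code $\mathcal{C}\subseteq 2^{\{1,2,3\}}$ that is not box-convex is obtained from one of them by a permutation of $\{1,2,3\}$.
   Context: Write $[n]=\{1,\ldots,n\}$. A code is a set $\mathcal{C}\subseteq 2^{[n]}$; subsets of $[n]$ are abbreviated by listing their elements, e.g. $12=\{1,2\}$. For an ordered (indexed) collection $\mathcal{U} = \{U_1, \ldots, U_n\}$ of sets in $\mathbb{R}^d$, its code is $$\operatorname{code}(\mathcal{U}) = \{\sigma\subseteq [n] \mid \text{there exists } p\in \mathbb{R}^d \text{ such that for all } i\in[n],\ p\in U_i \text{ if and only if } i\in\sigma\},$$ and $\mathcal{U}$ is called a realization of $\operatorname{code}(\mathcal{U})$. By standing convention, all sets in realizations are bounded (so every realizable code contains $\emptyset$), and $d\geq 1$. A code is convex if it is open convex or closed convex, i.e. if for some $d$ it has a realization in $\mathbb{R}^d$ in which every set is open and convex, or one in which every set is closed and convex. An axis-parallel box (box for short) in $\mathbb{R}^d$ is either the empty set or a product $[a_1,b_1]\times\cdots\times[a_d,b_d]$ of nonempty closed intervals (degenerate intervals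 $a_i=b_i$ allowed). A code is box-convex if, for some $d$, it has a realization in $\mathbb{R}^d$ in which every set is a box. -}

module Defs where

open import Algebra.Bundles using (CommutativeRing)
open import Data.Fin.Base using (Fin)
open import Data.Fin.Patterns using (0F; 1F; 2F)
open import Data.Fin.Permutation using (Permutation′; _⟨$⟩ʳ_)
open import Data.Fin.Subset using (Subset; ⁅_⁆; _∪_; ⊤; ⊥)
  renaming (_∈_ to _∈ˢ_)
open import Data.List.Base using (List; []; _∷_)
open import Data.List.Membership.Propositional using () renaming (_∈_ to _∈ˡ_)
open import Data.Nat.Base using (ℕ) renaming (_<_ to _<ᴺ_)
open import Data.Product.Base using (∃; ∃-syntax; _×_)
open import Data.Sum.Base using (_⊎_)
open import Data.Vec.Base using (lookup; tabulate)
open import Data.Vec.Functional using (Vector)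
open import Function.Bundles using (_⇔_)
open import Level using (0ℓ; suc)
import Relation.Binary.Construct.NonStrictToStrict as ToStrict
open import Relation.Binary.Core using (Rel)
open import Relation.Binary.Structures using (IsTotalOrder)
open import Relation.Nullary using (¬_)
open import Relation.Unary using (Pred; _∈_; _≐_; ∁; Empty; Satisfiable)

-- The real numbers, axiomatised as a Dedekind-complete ordered field: any two
-- such fields are isomorphic.
record CompleteOrderedField : Set (suc 0ℓ) where
  infix 4 _≤_
  field
    commutativeRing : CommutativeRing 0ℓ 0ℓ
  open CommutativeRing commutativeRing public
  field
    _≤_          : Rel Carrier 0ℓ
    isTotalOrder : IsTotalOrder _≈_ _≤_
    1≉0          : ¬ (1# ≈ 0#)
    inverse      : ∀ x → ¬ (x ≈ 0#) → ∃[ y ] x * y ≈ 1#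
    +-monoˡ-≤    : ∀ {x y} z → x ≤ y → x + z ≤ y + z
    *-nonNeg     : ∀ {x y} → 0# ≤ x → 0# ≤ y → 0# ≤ x * y

  UpperBound : Pred Carrier 0ℓ → Pred Carrier 0ℓ
  UpperBound S u = ∀ {x} → x ∈ S → x ≤ u

  field
    complete : (S : Pred Carrier 0ℓ) → Satisfiable S → Satisfiable (UpperBound S) →
               ∃[ s ] s ∈ UpperBound S × (∀ {u} → u ∈ UpperBound S → s ≤ u)

  open ToStrict _≈_ _≤_ public using (_<_)

Code : ℕ → Set (suc 0ℓ)
Code n = Pred (Subset n) 0ℓ

module _ (ℝ : CompleteOrderedField) where
  open CompleteOrderedField ℝ

  Point : ℕ → Set
  Point d = Vector Carrier d

  -- Subsets are not required to respect the pointwise _≈_ on points. This is no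
  -- loss: open sets and boxes respect it automatically, and so, classically, do
  -- closed sets.
  Region : ℕ → Set (suc 0ℓ)
  Region d = Pred (Point d) 0ℓ

  IsBounded : ∀ {d} → Region d → Set
  IsBounded U = ∃[ M ] (∀ {p} → p ∈ U → ∀ i → (- M ≤ p i) × (p i ≤ M))

  -- The usual topology of ℝᵈ, with open cubes as basic neighbourhoods.
  Cube : ∀ {d} → Point d → Carrier → Region d
  Cube p ε q = ∀ i → (p i - ε < q i) × (q i < p i + ε)

  IsOpen : ∀ {d} → Region d → Set
  IsOpen U = ∀ {p} → p ∈ U → ∃[ ε ] 0# < ε × (∀ {q} → q ∈ Cube p ε → q ∈ U)

  IsClosed : ∀ {d} → Region d → Set
  IsClosed U = IsOpen (∁ U)

  IsConvex : ∀ {d} → Region d → Set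
  IsConvex U = ∀ {p q} → p ∈ U → q ∈ U → ∀ t → 0# ≤ t → t ≤ 1# →
               (λ i → t * p i + (1# - t) * q i) ∈ U

  Product : ∀ {d} → Point d → Point d → Region d
  Product a b p = ∀ i → (a i ≤ p i) × (p i ≤ b i)

  IsBox : ∀ {d} → Region d → Set
  IsBox U = Empty U ⊎ ∃[ a ] ∃[ b ] (∀ i → a i ≤ b i) × U ≐ Product a b

  code : ∀ {n d} → (Fin n → Region d) → Code n
  code U σ = ∃[ p ] (∀ i → p ∈ U i ⇔ i ∈ˢ σ)

  RealizableBy : ∀ {n} → (∀ {d} → Region d → Set) → Code n → Set (suc 0ℓ)
  RealizableBy {n} P 𝒞 =
    ∃[ d ] 0 <ᴺ d ×
    (∃ λ (U : Fin n → Region d) →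
      (∀ i → IsBounded (U i)) × (∀ i → P (U i)) × code U ≐ 𝒞)

  OpenConvex ClosedConvex Convex BoxConvex : ∀ {n} → Code n → Set (suc 0ℓ)
  OpenConvex   = RealizableBy (λ U → IsOpen U × IsConvex U)
  ClosedConvex = RealizableBy (λ U → IsClosed U × IsConvex U)
  Convex 𝒞     = OpenConvex 𝒞 ⊎ ClosedConvex 𝒞
  BoxConvex    = RealizableBy IsBox

-- σ ∈ π · 𝒞 iff π⁻¹(σ) ∈ 𝒞, so that π · 𝒞 = { π(τ) ∣ τ ∈ 𝒞 }.
_·_ : ∀ {n} → Permutation′ n → Code n → Code n
(π · 𝒞) σ = tabulate (λ i → lookup σ (π ⟨$⟩ʳ i)) ∈ 𝒞

infix 4 _∼_
_∼_ : ∀ {n} → Code n → Code n → Set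
𝒞 ∼ 𝒟 = ∃[ π ] 𝒞 ≐ (π · 𝒟)

-- The paper's indices 1, 2, 3 are the elements 0F, 1F, 2F of Fin 3.
s1 s2 s3 s12 s13 s23 s123 ∅ : Subset 3
s1   = ⁅ 0F ⁆
s2   = ⁅ 1F ⁆
s3   = ⁅ 2F ⁆
s12  = s1 ∪ s2
s13  = s1 ∪ s3
s23  = s2 ∪ s3
s123 = ⊤
∅    = ⊥

C₁ C₂ C₃ : Code 3
C₁ = _∈ˡ (s123 ∷ s12 ∷ s13 ∷ s23 ∷ ∅ ∷ [])
C₂ = _∈ˡ (s123 ∷ s12 ∷ s13 ∷ s23 ∷ s1 ∷ ∅ ∷ [])
C₃ = _∈ˡ (s12 ∷ s13 ∷ s23 ∷ s1 ∷ s2 ∷ s3 ∷ ∅ ∷ [])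

{-# OPTIONS --safe #-}
module Submission where

-- A box is a product of intervals, so membership can be tested one coordinate at a time. Suppose 12, 13
-- and 23 occur in a code realised by boxes. Coordinatewise medians of three such points lie in all three
-- boxes, so 123 occurs; and exchanging a single coordinate between two of the points produces a point
-- in the second or in the third box alone. This excludes C₁, C₂ and C₃, which are realised by closed
-- convex polygons in the plane.
--
-- Conversely, let 12 and 13 occur in a convex code but neither 123 nor 1. A segment in the first set
-- joins the second set to the third; these cover it, are disjoint and both relatively open in it (whether
-- all sets are open or all are closed), which contradicts connectedness. The finitely many codes that
-- contain ∅ and satisfy this condition can be listed: up to permutation each is C₁, C₂, C₃ or the code
-- of some boxes in the plane with corners in {1, 3, 5}².

open import Defs
open import Axiom.ExcludedMiddle using (ExcludedMiddle)
open import Algebra.Solver.Ring.AlmostCommutativeRing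
  using (fromCommutativeRing; _-Raw-AlmostCommutative⟶_)
import Algebra.Properties.AbelianGroup as AbelianGroupProperties
import Algebra.Properties.Ring as RingProperties
import Algebra.Properties.Semiring.Mult.TCOptimised as Multiples
import Algebra.Solver.Ring as RingSolver
open import Data.Bool.Base using (Bool; true; false)
import Data.Bool.Properties as Bool
open import Data.Empty using (⊥-elim) renaming (⊥ to Absurd)
open import Data.Fin.Base using (Fin; zero; suc; fromℕ<; toℕ)
open import Data.Fin.Patterns using (0F; 1F; 2F; 3F; 4F; 5F; 6F; 7F)
open import Data.Fin.Permutation as Permutation using (Permutation′; transpose; _⟨$⟩ʳ_)
import Data.Fin.Properties as Fin
open import Data.Fin.Subset using (Subset; ⁅_⁆) renaming (_∈_ to _∈ˢ_)
open import Data.Fin.Subset.Properties using (_∈?_; ⊆-antisym; anySubset?; x∈⁅y⁆⇔x≡y)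
open import Data.Integer.Base as ℤ using (ℤ; +_; -[1+_]; _⊖_)
import Data.Integer.Properties as ℤ
open import Data.List.Base as List using (List; []; _∷_; cartesianProductWith; concatMap; upTo)
import Data.List.Membership.DecPropositional as DecMembership
open import Data.List.Membership.Propositional using (find) renaming (_∈_ to _∈ˡ_)
open import Data.List.Membership.Propositional.Properties
  using (∈-cartesianProductWith⁺; ∈-cartesianProductWith⁻; ∈-map⁻; ∈-upTo⁺)
open import Data.List.Relation.Unary.All as All using (All; []; _∷_)
open import Data.List.Relation.Unary.All.Properties using (¬All⇒Any¬)
open import Data.List.Relation.Unary.Any using (here; there)
open import Data.Maybe.Base using (map)
open import Data.Nat.Base as ℕ using (ℕ; zero; suc)
import Data.Nat.Properties as ℕ
open import Data.Product.Base using (∃-syntax; _×_; _,_; proj₁; proj₂)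
import Data.Sign.Base as Sign
open import Data.Sum.Base as Sum using (_⊎_; inj₁; inj₂; [_,_]′)
open import Data.Vec.Base as Vec using (Vec; []; _∷_; lookup; tabulate)
open import Data.Vec.Functional using (updateAt)
open import Data.Vec.Functional.Properties using (updateAt-updates; updateAt-minimal)
open import Data.Vec.Properties as Vec
  using ([]=⇒lookup; lookup⇒[]=; lookup-map; lookup-replicate; tabulate-cong; tabulate∘lookup)
open import Function.Base using (_∘_; const; id)
open import Function.Bundles using (_⇔_; mk⇔; Equivalence; Injection)
open import Function.Construct.Symmetry using (⇔-sym)
open import Function.Properties.Inverse using (↔⇒↣)
open import Level using (0ℓ)
open import Relation.Binary.Bundles using (TotalOrder)
import Relation.Binary.Construct.NonStrictToStrict as ToStrict
open import Relation.Binary.PropositionalEquality as ≡ using (_≡_; _≢_)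
import Relation.Binary.Reasoning.PartialOrder as OrderReasoning
open import Relation.Nullary using (¬_; Dec; yes; no; contradiction; does; Reflects; ofʸ; ofⁿ)
open import Relation.Nullary.Decidable as Dec
  using (dec⇒maybe; decidable-stable; from-no; proof; ¬?; _×-dec_; _⊎-dec_; _→-dec_)
open import Relation.Nullary.Reflects using (det)
open import Relation.Unary using (Pred; Decidable; Satisfiable; _∈_; _∉_; _≐_)

open Equivalence using (to; from)

-- Arithmetic in an ordered field.

module OrderedField (ℝ : CompleteOrderedField) where
  open CompleteOrderedField ℝ hiding (zero)

  totalOrder : TotalOrder 0ℓ 0ℓ 0ℓ
  totalOrder = record { isTotalOrder = isTotalOrder }

  open TotalOrder totalOrder public
    using (poset; total; antisym; ≤-respˡ-≈; ≤-respʳ-≈)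
    renaming (refl to ≤-refl; trans to ≤-trans; reflexive to ≤-reflexive)
  open RingProperties ring using (-‿distribˡ-*; -‿distribʳ-*)
  open AbelianGroupProperties +-abelianGroup
    using (ε⁻¹≈ε; ⁻¹-involutive; ⁻¹-∙-comm; x∙y⁻¹≈ε⇒x≈y; xyx⁻¹≈y)
  open Multiples semiring using (×-homo-+; ×1-homo-*; 1+×) renaming (_×_ to _·ᴺ_)
  open OrderReasoning poset

  -- With these multiples ι 1 reduces to 1#, as needed by the solver constant con (+ 1).
  ι : ℕ → Carrier
  ι n = n ·ᴺ 1#

  ιℤ : ℤ → Carrier
  ιℤ (+ n)    = ι n
  ιℤ -[1+ n ] = - ι (suc n)

  ιℤ-neg : ∀ i → ιℤ (ℤ.- i) ≈ - ιℤ i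
  ιℤ-neg (+ zero)  = sym ε⁻¹≈ε
  ιℤ-neg (+ suc n) = refl
  ιℤ-neg -[1+ n ]  = sym (⁻¹-involutive _)

  ιℤ-⊖ : ∀ m n → ιℤ (m ⊖ n) ≈ ι m - ι n
  ιℤ-⊖ zero zero = sym (-‿inverseʳ 0#)
  ιℤ-⊖ zero (suc n) = sym (+-identityˡ _)
  ιℤ-⊖ (suc m) zero = sym (trans (+-congˡ ε⁻¹≈ε) (+-identityʳ _))
  ιℤ-⊖ (suc m) (suc n) = begin-equality
    ιℤ (suc m ⊖ suc n)              ≡⟨ ≡.cong ιℤ (ℤ.[1+m]⊖[1+n]≡m⊖n m n) ⟩
    ιℤ (m ⊖ n)                      ≈⟨ ιℤ-⊖ m n ⟩
    ι m - ι n                       ≈⟨ +-congʳ (xyx⁻¹≈y 1# _) ⟨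
    1# + ι m - 1# - ι n             ≈⟨ +-assoc _ _ _ ⟩
    1# + ι m + (- 1# - ι n)         ≈⟨ +-congˡ (⁻¹-∙-comm _ _) ⟩
    1# + ι m - (1# + ι n)           ≈⟨ +-cong (1+× m 1#) (-‿cong (1+× n 1#)) ⟨
    ι (suc m) - ι (suc n)           ∎

  ιℤ-+ : ∀ i j → ιℤ (i ℤ.+ j) ≈ ιℤ i + ιℤ j
  ιℤ-+ (+ m)    (+ n)    = ×-homo-+ 1# m n
  ιℤ-+ (+ m)    -[1+ n ] = ιℤ-⊖ m (suc n)
  ιℤ-+ -[1+ m ] (+ n)    = trans (ιℤ-⊖ n (suc m)) (+-comm _ _)
  ιℤ-+ -[1+ m ] -[1+ n ] = begin-equality
    - ι (suc (suc (m ℕ.+ n)))   ≡⟨ ≡.cong (λ k → - ι (suc k)) (ℕ.+-suc m n) ⟨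
    - ι (suc m ℕ.+ suc n)       ≈⟨ -‿cong (×-homo-+ 1# (suc m) (suc n)) ⟩
    - (ι (suc m) + ι (suc n))   ≈⟨ ⁻¹-∙-comm _ _ ⟨
    - ι (suc m) - ι (suc n)     ∎

  ιℤ--◃ : ∀ n → ιℤ (Sign.- ℤ.◃ n) ≈ - ι n
  ιℤ--◃ zero    = sym ε⁻¹≈ε
  ιℤ--◃ (suc n) = refl

  ιℤ-* : ∀ i j → ιℤ (i ℤ.* j) ≈ ιℤ i * ιℤ j
  ιℤ-* (+ m)    (+ n)    = trans (reflexive (≡.cong ιℤ (ℤ.+◃n≡+n (m ℕ.* n)))) (×1-homo-* m n)
  ιℤ-* (+ m)    -[1+ n ] = begin-equality
    ιℤ (Sign.- ℤ.◃ (m ℕ.* suc n))   ≈⟨ ιℤ--◃ (m ℕ.* suc n) ⟩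
    - ι (m ℕ.* suc n)               ≈⟨ -‿cong (×1-homo-* m (suc n)) ⟩
    - (ι m * ι (suc n))             ≈⟨ -‿distribʳ-* _ _ ⟩
    ι m * - ι (suc n)               ∎
  ιℤ-* -[1+ m ] (+ n)    = begin-equality
    ιℤ (Sign.- ℤ.◃ (suc m ℕ.* n))   ≈⟨ ιℤ--◃ (suc m ℕ.* n) ⟩
    - ι (suc m ℕ.* n)               ≈⟨ -‿cong (×1-homo-* (suc m) n) ⟩
    - (ι (suc m) * ι n)             ≈⟨ -‿distribˡ-* _ _ ⟩
    - ι (suc m) * ι n               ∎
  ιℤ-* -[1+ m ] -[1+ n ] = begin-equality
    ι (suc m ℕ.* suc n)             ≈⟨ ×1-homo-* (suc m) (suc n) ⟩
    ι (suc m) * ι (suc n)           ≈⟨ ⁻¹-involutive _ ⟨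
    - - (ι (suc m) * ι (suc n))     ≈⟨ -‿cong (-‿distribˡ-* _ _) ⟩
    - (- ι (suc m) * ι (suc n))     ≈⟨ -‿distribʳ-* _ _ ⟩
    - ι (suc m) * - ι (suc n)       ∎

  -- Equality in the field comes with no decision procedure, so the ring solver computes with
  -- integer coefficients and interprets them through `ιℤ`.
  ιℤ-homomorphism : ℤ.+-*-rawRing -Raw-AlmostCommutative⟶ fromCommutativeRing commutativeRing
  ιℤ-homomorphism = record
    { ⟦_⟧ = ιℤ ; +-homo = ιℤ-+ ; *-homo = ιℤ-* ; -‿homo = ιℤ-neg ; 0-homo = refl ; 1-homo = refl }

  open RingSolver ℤ.+-*-rawRing (fromCommutativeRing commutativeRing) ιℤ-homomorphism
    (λ i j → map (reflexive ∘ ≡.cong ιℤ) (dec⇒maybe (i ℤ.≟ j)))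
    public using (solve; _:=_; _:+_; _:*_; _:-_; :-_; con)

  ≤⇒0≤- : ∀ {x y} → x ≤ y → 0# ≤ y - x
  ≤⇒0≤- {x} {y} x≤y = ≤-respˡ-≈ (-‿inverseʳ x) (+-monoˡ-≤ (- x) x≤y)

  -- Turns an inequality into a ring identity for the solver: `e` is the difference, written so that
  -- its sign is evident.
  ≤-by : ∀ {x y e} → 0# ≤ e → y ≈ x + e → x ≤ y
  ≤-by {x} {y} {e} 0≤e y≈x+e = begin
    x        ≈⟨ +-identityˡ x ⟨
    0# + x   ≤⟨ +-monoˡ-≤ x 0≤e ⟩
    e + x    ≈⟨ +-comm e x ⟩
    x + e    ≈⟨ y≈x+e ⟨
    y        ∎

  <⇒≤ : ∀ {x y} → x < y → x ≤ y
  <⇒≤ = proj₁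

  <⇒0<- : ∀ {x y} → x < y → 0# < y - x
  <⇒0<- (x≤y , x≉y) = ≤⇒0≤- x≤y , λ 0≈y-x → x≉y (sym (x∙y⁻¹≈ε⇒x≈y _ _ (sym 0≈y-x)))

  <-by : ∀ {x y e} → 0# < e → y ≈ x + e → x < y
  <-by {x} {y} {e} (0≤e , 0≉e) y≈x+e = ≤-by 0≤e y≈x+e , λ x≈y → 0≉e (begin-equality
    0#           ≈⟨ -‿inverseˡ x ⟨
    - x + x      ≈⟨ +-congˡ (trans x≈y y≈x+e) ⟩
    - x + (x + e) ≈⟨ solve 2 (λ x e → :- x :+ (x :+ e) := e) refl x e ⟩
    e            ∎)

  <-≤-trans : ∀ {x y z} → x < y → y ≤ z → x < z
  <-≤-trans = ToStrict.<-≤-trans _≈_ _≤_ sym ≤-trans antisym ≤-respʳ-≈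

  ≤-<-trans : ∀ {x y z} → x ≤ y → y < z → x < z
  ≤-<-trans = ToStrict.≤-<-trans _≈_ _≤_ ≤-trans antisym ≤-respˡ-≈

  <⇒≱ : ∀ {x y} → x < y → ¬ (y ≤ x)
  <⇒≱ = ToStrict.<⇒≱ _≈_ _≤_ antisym

  ≰⇒> : ∀ {x y} → ¬ (x ≤ y) → y < x
  ≰⇒> = ToStrict.≰⇒> _≈_ _≤_ sym ≤-reflexive total

  <-respʳ-≈ : ∀ {x y z} → y ≈ z → x < y → x < z
  <-respʳ-≈ = ToStrict.<-respʳ-≈ _≈_ _≤_ sym trans ≤-respʳ-≈

  +-nonNeg : ∀ {x y} → 0# ≤ x → 0# ≤ y → 0# ≤ x + y
  +-nonNeg {x} {y} 0≤x 0≤y = ≤-trans 0≤x (≤-by 0≤y refl)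

  +-nonNeg-pos : ∀ {x y} → 0# ≤ x → 0# < y → 0# < x + y
  +-nonNeg-pos 0≤x 0<y = ≤-<-trans 0≤x (<-by 0<y refl)

  -- If `x * y` vanished, multiplying by the inverse of `x` would make `y` vanish.
  *-pos : ∀ {x y} → 0# < x → 0# < y → 0# < x * y
  *-pos {x} {y} (0≤x , 0≉x) (0≤y , 0≉y) = *-nonNeg 0≤x 0≤y , λ 0≈xy →
    let z , xz≈1 = inverse x (0≉x ∘ sym) in 0≉y (begin-equality
      0#            ≈⟨ zeroʳ z ⟨
      z * 0#        ≈⟨ *-congˡ 0≈xy ⟩
      z * (x * y)   ≈⟨ solve 3 (λ x y z → z :* (x :* y) := x :* z :* y) refl x y z ⟩
      x * z * y     ≈⟨ *-congʳ xz≈1 ⟩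
      1# * y        ≈⟨ *-identityˡ y ⟩
      y             ∎)

  *-monoʳ-≤ : ∀ {x y z} → 0# ≤ z → x ≤ y → z * x ≤ z * y
  *-monoʳ-≤ {x} {y} {z} 0≤z x≤y = ≤-by (*-nonNeg 0≤z (≤⇒0≤- x≤y))
    (solve 3 (λ x y z → z :* y := z :* x :+ z :* (y :- x)) refl x y z)

  +-mono-≤ : ∀ {w x y z} → w ≤ x → y ≤ z → w + y ≤ x + z
  +-mono-≤ {w} {x} {y} {z} w≤x y≤z = ≤-by (+-nonNeg (≤⇒0≤- w≤x) (≤⇒0≤- y≤z))
    (solve 4 (λ w x y z → x :+ z := w :+ y :+ (x :- w :+ (z :- y))) refl w x y z)

  +-mono-< : ∀ {w x y z} → w < x → y < z → w + y < x + z
  +-mono-< {w} {x} {y} {z} w<x y<z = <-by (+-nonNeg-pos (<⇒≤ (<⇒0<- w<x)) (<⇒0<- y<z))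
    (solve 4 (λ w x y z → x :+ z := w :+ y :+ (x :- w :+ (z :- y))) refl w x y z)

  0≤1 : 0# ≤ 1#
  0≤1 with total 0# 1#
  ... | inj₁ 0≤1 = 0≤1
  -- Here `0# - 1#` is nonnegative, hence so is its square, which is 1.
  ... | inj₂ 1≤0 = ≤-respʳ-≈ (solve 0 ((con (+ 0) :- con (+ 1)) :* (con (+ 0) :- con (+ 1)) := con (+ 1)) refl)
                     (*-nonNeg (≤⇒0≤- 1≤0) (≤⇒0≤- 1≤0))

  0<1 : 0# < 1#
  0<1 = 0≤1 , 1≉0 ∘ sym

  divide : ∀ {x y} → 0# < x → 0# < y → ∃[ z ] 0# < z × x * z ≈ y
  divide {x} {y} 0<x@(0≤x , 0≉x) 0<y with z , xz≈1 ← inverse x (0≉x ∘ sym) =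
    z * y , *-pos 0<z 0<y , (begin-equality
      x * (z * y)   ≈⟨ *-assoc _ _ _ ⟨
      x * z * y     ≈⟨ *-congʳ xz≈1 ⟩
      1# * y        ≈⟨ *-identityˡ y ⟩
      y             ∎)
    where
    0<z : 0# < z
    0<z = ≰⇒> λ z≤0 → <⇒≱ 0<1 (begin
      1#       ≈⟨ xz≈1 ⟨
      x * z    ≤⟨ *-monoʳ-≤ 0≤x z≤0 ⟩
      x * 0#   ≈⟨ zeroʳ x ⟩
      0#       ∎)

  ι-+ : ∀ m n → ι (m ℕ.+ n) ≈ ι m + ι n
  ι-+ = ×-homo-+ 1#

  0≤ι : ∀ n → 0# ≤ ι n
  0≤ι zero    = ≤-refl
  0≤ι (suc n) = ≤-respʳ-≈ (sym (1+× n 1#)) (+-nonNeg 0≤1 (0≤ι n))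

  ι-mono-≤ : ∀ {m n} → m ℕ.≤ n → ι m ≤ ι n
  ι-mono-≤ {m} {n} m≤n = ≤-by (0≤ι (n ℕ.∸ m))
    (trans (reflexive (≡.cong ι (≡.sym (ℕ.m+[n∸m]≡n m≤n)))) (ι-+ m _))

  ι-mono-< : ∀ {m n} → m ℕ.< n → ι m < ι n
  ι-mono-< {m} m<n = <-≤-trans (<-by 0<1 (trans (1+× m 1#) (+-comm _ _))) (ι-mono-≤ m<n)

  ι-≤⇔ : ∀ m n → ι m ≤ ι n ⇔ m ℕ.≤ n
  ι-≤⇔ m n = mk⇔ (λ ιm≤ιn → ℕ.≮⇒≥ λ n<m → <⇒≱ (ι-mono-< n<m) ιm≤ιn) ι-mono-≤

-- Words as Boolean vectors, and admissible codes.

∀₃ : ∀ {P : Fin 3 → Set} → P 0F → P 1F → P 2F → ∀ i → P i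
∀₃ a b c 0F = a
∀₃ a b c 1F = b
∀₃ a b c 2F = c

-- The bits of a concrete word reduce, so in this form each bit yields a proof of membership or of
-- nonmembership.
∈⇔⇒Reflects : ∀ {n} {A : Set} {i : Fin n} (σ : Subset n) → A ⇔ i ∈ˢ σ → Reflects A (lookup σ i)
∈⇔⇒Reflects {i = i} σ A⇔i∈σ with lookup σ i in eq
... | true  = ofʸ (from A⇔i∈σ (lookup⇒[]= i σ eq))
... | false = ofⁿ λ a → contradiction (≡.trans (≡.sym ([]=⇒lookup (to A⇔i∈σ a))) eq) λ ()

Reflects⇒∈⇔ : ∀ {n} {A : Set} {i : Fin n} (σ : Subset n) → Reflects A (lookup σ i) → A ⇔ i ∈ˢ σ
Reflects⇒∈⇔ {i = i} σ r with lookup σ i in eq | r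
... | true  | ofʸ a  = mk⇔ (λ _ → lookup⇒[]= i σ eq) (λ _ → a)
... | false | ofⁿ ¬a = mk⇔ (⊥-elim ∘ ¬a) λ i∈σ → contradiction (≡.trans (≡.sym ([]=⇒lookup i∈σ)) eq) λ ()

-- What connectedness forces on a convex code: a set that meets both others has a point common to
-- all three or a point outside both. The word `∅` occurs because all sets are bounded.
Admissible : Code 3 → Set
Admissible 𝒞 =
  𝒞 ∅ ×
  (𝒞 s12 → 𝒞 s13 → 𝒞 s123 ⊎ 𝒞 s1) ×
  (𝒞 s12 → 𝒞 s23 → 𝒞 s123 ⊎ 𝒞 s2) ×
  (𝒞 s13 → 𝒞 s23 → 𝒞 s123 ⊎ 𝒞 s3)

-- Integer data for polygons and boxes.

infix 6 _≼_ _≽_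

-- Bounds on the three quantities x, y and x + y.
data Constraint : Set where
  _≼_ _≽_ : Fin 3 → ℕ → Constraint

Polygon : Set
Polygon = List Constraint

coordinatesᴺ : ℕ → ℕ → Fin 3 → ℕ
coordinatesᴺ m n = ∀₃ m n (m ℕ.+ n)

Holdsᴺ : ℕ → ℕ → Constraint → Set
Holdsᴺ m n (i ≼ k) = coordinatesᴺ m n i ℕ.≤ k
Holdsᴺ m n (i ≽ k) = k ℕ.≤ coordinatesᴺ m n i

holdsᴺ? : ∀ m n → Decidable (Holdsᴺ m n)
holdsᴺ? m n (i ≼ k) = coordinatesᴺ m n i ℕ.≤? k
holdsᴺ? m n (i ≽ k) = k ℕ.≤? coordinatesᴺ m n i

-- The triangle with vertices (0,0), (5,0) and (0,5) is imposed on every polygon, which makes it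
-- bounded.
triangle : Polygon → Polygon
triangle P = 0F ≽ 0 ∷ 1F ≽ 0 ∷ 2F ≼ 5 ∷ P

contains : Polygon → ℕ → ℕ → Bool
contains P m n = does (All.all? (holdsᴺ? m n) (triangle P))

record Box : Set where
  constructor [_⋯_]×[_⋯_]
  field
    left right bottom top : Fin 3

-- The points 1, 3, 5 cut the line into seven cells: cell 2k + 1 is the point itself, cell 2k the open
-- interval before it. A box is given by the numbers k of its sides, and InCell is its trace on cells.
odd : ℕ → ℕ
odd k = suc (k ℕ.+ k)

odd-mono : ∀ {k m} → k ℕ.≤ m → odd k ℕ.≤ odd m
odd-mono k≤m = ℕ.s≤s (ℕ.+-mono-≤ k≤m k≤m)

odd-mono-< : ∀ {k m} → k ℕ.< m → odd k ℕ.< odd m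
odd-mono-< k<m = ℕ.s<s (ℕ.+-mono-< k<m k<m)

InCell : Box → ℕ → ℕ → Set
InCell [ l ⋯ r ]×[ b ⋯ t ] g h =
  (odd (toℕ l) ℕ.≤ g × g ℕ.≤ odd (toℕ r)) × (odd (toℕ b) ℕ.≤ h × h ℕ.≤ odd (toℕ t))

inCell? : ∀ B g h → Dec (InCell B g h)
inCell? [ l ⋯ r ]×[ b ⋯ t ] g h =
  (odd (toℕ l) ℕ.≤? g ×-dec g ℕ.≤? odd (toℕ r)) ×-dec (odd (toℕ b) ℕ.≤? h ×-dec h ℕ.≤? odd (toℕ t))

cell-word : Vec Box 3 → ℕ → ℕ → Subset 3
cell-word Bs g h = Vec.map (λ B → does (inCell? B g h)) Bs

cell-words : Vec Box 3 → List (Subset 3)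
cell-words Bs = cartesianProductWith (cell-word Bs) (upTo 7) (upTo 7)

word-unique : ∀ {n} {P : Fin n → Set} {σ τ : Subset n} →
  (∀ i → P i ⇔ i ∈ˢ σ) → (∀ i → P i ⇔ i ∈ˢ τ) → σ ≡ τ
word-unique P⇔σ P⇔τ =
  ⊆-antisym (λ {i} → to (P⇔τ i) ∘ from (P⇔σ i)) (λ {i} → to (P⇔σ i) ∘ from (P⇔τ i))

-- Words of points, and relatively open sets.

module Geometry (em : ExcludedMiddle 0ℓ) (ℝ : CompleteOrderedField) where
  open CompleteOrderedField ℝ hiding (zero)
  open OrderedField ℝ

  by-contradiction : {A : Set} → ¬ ¬ A → A
  by-contradiction = decidable-stable em

  module _ {n d : ℕ} {U : Fin n → Region ℝ d} where

    word-at : ∀ {p σ} → (∀ i → Reflects (p ∈ U i) (lookup σ i)) → code ℝ U σ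
    word-at {p} {σ} r = p , λ i → Reflects⇒∈⇔ σ (r i)

    point-of : ∀ {σ} → code ℝ U σ → ∃[ p ] ∀ i → Reflects (p ∈ U i) (lookup σ i)
    point-of {σ} (p , p∈) = p , λ i → ∈⇔⇒Reflects σ (p∈ i)

  true-of : ∀ {A : Set} → Reflects A true → A
  true-of (ofʸ a) = a

  false-of : ∀ {A : Set} → Reflects A false → ¬ A
  false-of (ofⁿ ¬a) = ¬a

  -‿< : ∀ {x y z} → x < y + z → x - z < y
  -‿< {x} {y} {z} x<y+z = <-by (<⇒0<- x<y+z)
    (solve 3 (λ x y z → y := x :- z :+ (y :+ z :- x)) refl x y z)

  -‿<⁻ : ∀ {x y z} → x - z < y → x < y + z
  -‿<⁻ {x} {y} {z} x-z<y = <-by (<⇒0<- x-z<y)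
    (solve 3 (λ x y z → y :+ z := x :+ (y :- (x :- z))) refl x y z)

  -‿≤⁻ : ∀ {x y z} → x - z ≤ y → x ≤ y + z
  -‿≤⁻ {x} {y} {z} x-z≤y = ≤-by (≤⇒0≤- x-z≤y)
    (solve 3 (λ x y z → y :+ z := x :+ (y :- (x :- z))) refl x y z)

  x≤x+ : ∀ {x δ} → 0# < δ → x ≤ x + δ
  x≤x+ 0<δ = ≤-by (<⇒≤ 0<δ) refl

  -- Relative openness of `V` in `U`, the common form in which open and closed realizations enter
  -- the connectedness argument.
  OpenIn : ∀ {d} → Region ℝ d → Region ℝ d → Set
  OpenIn U V = ∀ {x} → x ∈ U → x ∈ V →
               ∃[ ε ] 0# < ε × (∀ {y} → y ∈ U → y ∈ Cube ℝ x ε → y ∈ V)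

  module _ {d : ℕ} {U V : Region ℝ d} where

    open⇒openIn : IsOpen ℝ V → OpenIn U V
    open⇒openIn V-open _ x∈V = let ε , 0<ε , ball = V-open x∈V in ε , 0<ε , λ _ → ball

    -- Within `U`, `V` is the complement of the closed set `W`.
    closed⇒openIn : ∀ {W} → IsClosed ℝ W →
                    (∀ {x} → x ∈ U → x ∈ V ⊎ x ∈ W) → (∀ {x} → x ∈ U → x ∈ V → x ∉ W) → OpenIn U V
    closed⇒openIn W-closed cover disjoint x∈U x∈V =
      let ε , 0<ε , ball = W-closed (disjoint x∈U x∈V)
      in ε , 0<ε , λ y∈U y∈cube → [ id , (λ y∈W → contradiction y∈W (ball y∈cube)) ]′ (cover y∈U)

  -- Connectedness of segments.

  segment : ∀ {d} → Point ℝ d → Point ℝ d → Carrier → Point ℝ d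
  segment p q t i = t * p i + (1# - t) * q i

  segment-0 : ∀ {d} {p q : Point ℝ d} i → q i ≈ segment p q 0# i
  segment-0 {p = p} {q} i =
    solve 2 (λ p q → q := con (+ 0) :* p :+ (con (+ 1) :- con (+ 0)) :* q) refl (p i) (q i)

  segment-1 : ∀ {d} {p q : Point ℝ d} i → p i ≈ segment p q 1# i
  segment-1 {p = p} {q} i =
    solve 2 (λ p q → p := con (+ 1) :* p :+ (con (+ 1) :- con (+ 1)) :* q) refl (p i) (q i)

  module Segment {d : ℕ} (0<d : 0 ℕ.< d) {U : Region ℝ d}
                 (U-convex : IsConvex ℝ U) (U-bounded : IsBounded ℝ U)
                 {p q : Point ℝ d} (p∈U : p ∈ U) (q∈U : q ∈ U) where

    -- `K` exceeds every coordinate difference of points of `U`, so it is a Lipschitz constant for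
    -- the segment. The summand `1#` makes it positive and the bound strict.
    M K : Carrier
    M = proj₁ U-bounded
    K = M + M + 1#

    0<K : 0# < K
    -- `M + M` is nonnegative because some coordinate of `p` lies between `- M` and `M`; positive
    -- dimension supplies that coordinate.
    0<K = let -M≤ , ≤M = proj₂ U-bounded p∈U (fromℕ< 0<d) in
      +-nonNeg-pos (≤-respʳ-≈ (solve 1 (λ M → M :- :- M := M :+ M) refl M) (≤⇒0≤- (≤-trans -M≤ ≤M))) 0<1

    difference<K : ∀ {p q} → p ∈ U → q ∈ U → ∀ i → p i - q i < K
    difference<K {p} {q} p∈U q∈U i =
      let _ , p≤M = proj₂ U-bounded p∈U i ; -M≤q , _ = proj₂ U-bounded q∈U i in
      <-by (+-nonNeg-pos (+-nonNeg (≤⇒0≤- p≤M) (≤⇒0≤- -M≤q)) 0<1)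
        (solve 3 (λ M x y → M :+ M :+ con (+ 1) := x :- y :+ (M :- x :+ (y :- :- M) :+ con (+ 1))) refl M (p i) (q i))

    seg = segment p q

    -- Along the segment, coordinate `i` has slope `p i - q i`, of absolute value below `K`. The
    -- sign of the slope decides which of the two bounds on the parameters is used.
    seg-< : ∀ {δ t u} → 0# < δ → t ≤ u + δ → u ≤ t + δ → ∀ i → seg t i < seg u i + K * δ
    seg-< {δ} {t} {u} 0<δ t≤u+δ u≤t+δ i with total 0# (p i - q i)
    ... | inj₁ 0≤D = <-by
      (+-nonNeg-pos (*-nonNeg (≤⇒0≤- t≤u+δ) 0≤D) (*-pos 0<δ (<⇒0<- (difference<K p∈U q∈U i))))
      (solve 6 (λ p q t u δ K →
          u :* p :+ (con (+ 1) :- u) :* q :+ K :* δ :=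
          t :* p :+ (con (+ 1) :- t) :* q :+ ((u :+ δ :- t) :* (p :- q) :+ δ :* (K :- (p :- q))))
        refl (p i) (q i) t u δ K)
    ... | inj₂ D≤0 = <-by
      (+-nonNeg-pos (*-nonNeg (≤⇒0≤- u≤t+δ) (≤⇒0≤- D≤0)) (*-pos 0<δ (<⇒0<- (difference<K q∈U p∈U i))))
      (solve 6 (λ p q t u δ K →
          u :* p :+ (con (+ 1) :- u) :* q :+ K :* δ :=
          t :* p :+ (con (+ 1) :- t) :* q :+ ((t :+ δ :- u) :* (con (+ 0) :- (p :- q)) :+ δ :* (K :- (q :- p))))
        refl (p i) (q i) t u δ K)

    -- Relative openness pulls back to the parameter interval: by the Lipschitz bound, the radius ε
    -- divided by `K` serves.
    openIn-seg : ∀ {V} → OpenIn U V → ∀ {t} → 0# ≤ t → t ≤ 1# → seg t ∈ V →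
                 ∃[ δ ] 0# < δ × (∀ {u} → 0# ≤ u → u ≤ 1# → t ≤ u + δ → u ≤ t + δ → seg u ∈ V)
    openIn-seg V-open {t} 0≤t t≤1 t∈V =
      let ε , 0<ε , ball = V-open (U-convex p∈U q∈U t 0≤t t≤1) t∈V ; δ , 0<δ , Kδ≈ε = divide 0<K 0<ε in
      δ , 0<δ , λ {u} 0≤u u≤1 t≤u+δ u≤t+δ → ball (U-convex p∈U q∈U u 0≤u u≤1) λ i →
        -‿< (<-respʳ-≈ (+-congˡ Kδ≈ε) (seg-< 0<δ t≤u+δ u≤t+δ i)) ,
        <-respʳ-≈ (+-congˡ Kδ≈ε) (seg-< 0<δ u≤t+δ t≤u+δ i)

    -- Regions need not respect `_≈_`, but inside `U` a relatively open one does, since equal points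
    -- lie in every cube about each other. The ends of the segment equal `p` and `q` only up to
    -- `_≈_`.
    openIn-≈ : ∀ {V x y} → OpenIn U V → x ∈ U → y ∈ U → (∀ i → x i ≈ y i) → x ∈ V → y ∈ V
    openIn-≈ V-open x∈U y∈U x≈y x∈V =
      let ε , 0<ε , ball = V-open x∈U x∈V in
      ball y∈U λ i → -‿< (<-by 0<ε (+-congʳ (sym (x≈y i)))) , <-by 0<ε (+-congʳ (x≈y i))

    -- The segment starts in `W` at parameter 0 and ends in `V` at parameter 1. The supremum `s` of
    -- the parameters belonging to `W` can belong to neither set.
    no-separation : ∀ {V W} → OpenIn U V → OpenIn U W →
                    (∀ {x} → x ∈ U → x ∈ V ⊎ x ∈ W) → (∀ {x} → x ∈ U → x ∈ V → x ∉ W) →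
                    p ∈ V → q ∈ W → Absurd
    no-separation {V} {W} V-open W-open cover disjoint p∈V q∈W = absurd
      where
      in-U : ∀ {t} → 0# ≤ t → t ≤ 1# → seg t ∈ U
      in-U = U-convex p∈U q∈U _

      S : Pred Carrier 0ℓ
      S t = 0# ≤ t × t ≤ 1# × seg t ∈ W

      0∈S : 0# ∈ S
      0∈S = ≤-refl , 0≤1 , openIn-≈ W-open q∈U (in-U ≤-refl 0≤1) segment-0 q∈W

      1∈V : seg 1# ∈ V
      1∈V = openIn-≈ V-open p∈U (in-U 0≤1 ≤-refl) segment-1 p∈V

      separated : (∃[ s ] s ∈ UpperBound S × (∀ {u} → u ∈ UpperBound S → s ≤ u)) → Absurd
      separated (s , s-upper , s-least) = [ s∉V , s∉W ]′ (cover (in-U 0≤s s≤1))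
        where
        0≤s : 0# ≤ s
        0≤s = s-upper 0∈S

        s≤1 : s ≤ 1#
        s≤1 = s-least λ t∈S → proj₁ (proj₂ t∈S)

        s∉V : seg s ∉ V
        s∉V s∈V =
          -- Parameters of `S` within `δ` of `s` would belong to both sets, so `s - δ` is already an
          -- upper bound.
          let δ , 0<δ , near = openIn-seg V-open 0≤s s≤1 s∈V
              before : ∀ {t} → t ∈ S → s - δ ≤ t → t ≤ s - δ
              before t∈S s-δ≤t =
                let 0≤t , t≤1 , t∈W = t∈S
                    t∈V = near 0≤t t≤1 (-‿≤⁻ s-δ≤t) (≤-trans (s-upper t∈S) (x≤x+ 0<δ))
                in contradiction t∈W (disjoint (in-U 0≤t t≤1) t∈V)
          in <⇒≱ (-‿< (<-by 0<δ refl)) (s-least λ t∈S → [ id , before t∈S ]′ (total _ (s - δ)))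

        s∉W : seg s ∉ W
        s∉W s∈W =
          let δ , 0<δ , near = openIn-seg W-open 0≤s s≤1 s∈W
              0≤s+δ = ≤-trans 0≤s (x≤x+ 0<δ)
          -- If `s + δ` is still a parameter, it lies in `S` and exceeds `s`; otherwise 1 is within
          -- `δ` of `s`, which puts the end of the segment into `W`.
          in [ (λ s+δ≤1 → <⇒≱ (<-by 0<δ refl) (s-upper (0≤s+δ , s+δ≤1 ,
                 near 0≤s+δ s+δ≤1 (≤-trans (x≤x+ 0<δ) (x≤x+ 0<δ)) ≤-refl)))
             , (λ 1≤s+δ → disjoint (in-U 0≤1 ≤-refl) 1∈V
                 (near 0≤1 ≤-refl (≤-trans s≤1 (x≤x+ 0<δ)) 1≤s+δ)) ]′ (total (s + δ) 1#)

      absurd : Absurd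
      absurd = separated (complete S (0# , 0∈S) (1# , λ t∈S → proj₁ (proj₂ t∈S)))

  -- Convex codes are admissible.

  strict-bound : ∀ {n} (f : Fin n → Carrier) → ∃[ b ] ∀ i → f i < b
  strict-bound {zero}  f = 0# , λ ()
  strict-bound {suc n} f with strict-bound (f ∘ suc)
  ... | b , f<b with total b (f zero + 1#)
  ...   | inj₁ b≤ = f zero + 1# , λ { zero → <-by 0<1 refl ; (suc i) → <-≤-trans (f<b i) b≤ }
  ...   | inj₂ ≤b = b , λ { zero → <-≤-trans (<-by 0<1 refl) ≤b ; (suc i) → f<b i }

  -- All coordinates of the point exceed every bound; since the dimension is positive, one such
  -- coordinate exists and excludes membership.
  far-point : ∀ {n d} → 0 ℕ.< d → (U : Fin n → Region ℝ d) → (∀ i → IsBounded ℝ (U i)) → ∃[ p ] ∀ i → p ∉ U i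
  far-point 0<d U bounded with b , M<b ← strict-bound (proj₁ ∘ bounded) =
    const b , λ i p∈U → <⇒≱ (M<b i) (proj₂ (proj₂ (bounded i) p∈U (fromℕ< 0<d)))

  -- Treats open and closed realizations at once. They differ only in why a set is relatively open
  -- in `U` when it and another set cover `U` and are disjoint there.
  realizable⇒admissible : ∀ {P : ∀ {d} → Region ℝ d → Set} →
    (∀ {d} {U : Region ℝ d} → P U → IsConvex ℝ U) →
    (∀ {d} {U V W : Region ℝ d} → P V → P W →
      (∀ {x} → x ∈ U → x ∈ V ⊎ x ∈ W) → (∀ {x} → x ∈ U → x ∈ V → x ∉ W) → OpenIn U V) →
    ∀ {𝒞 : Code 3} → RealizableBy ℝ P 𝒞 → Admissible 𝒞
  realizable⇒admissible convex open-in {𝒞} (d , 0<d , U , bounded , PU , word⇒ , ⇐word) =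
    occurs (far .proj₁) (∀₃ (ofⁿ (far .proj₂ 0F)) (ofⁿ (far .proj₂ 1F)) (ofⁿ (far .proj₂ 2F))) ,
    (λ c₁₂ c₁₃ → by-contradiction λ neither →
      let p , p∈ = point-of {U = U} (⇐word c₁₂) ; q , q∈ = point-of {U = U} (⇐word c₁₃) in
      meet 0F 1F 2F
        (λ x∈₁ x∉₂ x∉₃ → neither (inj₂ (occurs _ (∀₃ (ofʸ x∈₁) (ofⁿ x∉₂) (ofⁿ x∉₃)))))
        (λ x∈₁ x∈₂ x∈₃ → neither (inj₁ (occurs _ (∀₃ (ofʸ x∈₁) (ofʸ x∈₂) (ofʸ x∈₃)))))
        (true-of (p∈ 0F)) (true-of (p∈ 1F)) (true-of (q∈ 0F)) (true-of (q∈ 2F))) ,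
    (λ c₁₂ c₂₃ → by-contradiction λ neither →
      let p , p∈ = point-of {U = U} (⇐word c₁₂) ; q , q∈ = point-of {U = U} (⇐word c₂₃) in
      meet 1F 0F 2F
        (λ x∈₂ x∉₁ x∉₃ → neither (inj₂ (occurs _ (∀₃ (ofⁿ x∉₁) (ofʸ x∈₂) (ofⁿ x∉₃)))))
        (λ x∈₂ x∈₁ x∈₃ → neither (inj₁ (occurs _ (∀₃ (ofʸ x∈₁) (ofʸ x∈₂) (ofʸ x∈₃)))))
        (true-of (p∈ 1F)) (true-of (p∈ 0F)) (true-of (q∈ 1F)) (true-of (q∈ 2F))) ,
    (λ c₁₃ c₂₃ → by-contradiction λ neither →
      let p , p∈ = point-of {U = U} (⇐word c₁₃) ; q , q∈ = point-of {U = U} (⇐word c₂₃) in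
      meet 2F 0F 1F
        (λ x∈₃ x∉₁ x∉₂ → neither (inj₂ (occurs _ (∀₃ (ofⁿ x∉₁) (ofⁿ x∉₂) (ofʸ x∈₃)))))
        (λ x∈₃ x∈₁ x∈₂ → neither (inj₁ (occurs _ (∀₃ (ofʸ x∈₁) (ofʸ x∈₂) (ofʸ x∈₃)))))
        (true-of (p∈ 2F)) (true-of (p∈ 0F)) (true-of (q∈ 2F)) (true-of (q∈ 1F)))
    where
    far = far-point 0<d U bounded

    occurs : ∀ p {σ} → (∀ i → Reflects (p ∈ U i) (lookup σ i)) → 𝒞 σ
    occurs p r = word⇒ (word-at {U = U} {p} r)

    -- Otherwise `U j` and `U k` would separate the segment in `U i` from `p` to `q`.
    meet : ∀ i j k → (∀ {x} → x ∈ U i → x ∉ U j → x ∉ U k → Absurd) →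
           (∀ {x} → x ∈ U i → x ∈ U j → x ∈ U k → Absurd) →
           ∀ {p q} → p ∈ U i → p ∈ U j → q ∈ U i → q ∈ U k → Absurd
    meet i j k not-alone not-all p∈i p∈j q∈i q∈k =
      Segment.no-separation 0<d (convex (PU i)) (bounded i) p∈i q∈i
        (open-in (PU j) (PU k) cover not-all)
        (open-in (PU k) (PU j) ([ inj₂ , inj₁ ]′ ∘ cover) λ x∈i x∈k x∈j → not-all x∈i x∈j x∈k)
        cover not-all p∈j q∈k
      where
      cover : ∀ {x} → x ∈ U i → x ∈ U j ⊎ x ∈ U k
      cover {x} x∈i with em {x ∈ U j} | em {x ∈ U k}
      ... | yes x∈j | _       = inj₁ x∈j
      ... | no  _   | yes x∈k = inj₂ x∈k
      ... | no  x∉j | no  x∉k = ⊥-elim (not-alone x∈i x∉j x∉k)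

  convex⇒admissible : ∀ {𝒞 : Code 3} → Convex ℝ 𝒞 → Admissible 𝒞
  convex⇒admissible (inj₁ open-convex) = realizable⇒admissible {λ U → IsOpen ℝ U × IsConvex ℝ U} proj₂
    (λ (V-open , _) _ _ _ → open⇒openIn V-open) open-convex
  convex⇒admissible (inj₂ closed-convex) = realizable⇒admissible {λ U → IsClosed ℝ U × IsConvex ℝ U} proj₂
    (λ _ (W-closed , _) → closed⇒openIn W-closed) closed-convex

  -- Boxes: betweenness, medians and exchange of coordinates.

  _∈[_,_] : Carrier → Carrier → Carrier → Set
  x ∈[ a , b ] = (a ≤ x) × (x ≤ b)

  Between : Carrier → Carrier → Carrier → Set
  Between x y z = (x ≤ y) × (y ≤ z) ⊎ (z ≤ y) × (y ≤ x)

  between-convex : ∀ {a b x y z} → x ∈[ a , b ] → z ∈[ a , b ] → Between x y z → y ∈[ a , b ]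
  between-convex (a≤x , _) (_ , z≤b) (inj₁ (x≤y , y≤z)) = ≤-trans a≤x x≤y , ≤-trans y≤z z≤b
  between-convex (_ , x≤b) (a≤z , _) (inj₂ (z≤y , y≤x)) = ≤-trans a≤z z≤y , ≤-trans y≤x x≤b

  some-between : ∀ x y z → Between y x z ⊎ Between x y z ⊎ Between x z y
  some-between x y z with total x y | total y z | total x z
  ... | inj₁ x≤y | inj₁ y≤z | _        = inj₂ (inj₁ (inj₁ (x≤y , y≤z)))
  ... | inj₁ x≤y | inj₂ z≤y | inj₁ x≤z = inj₂ (inj₂ (inj₁ (x≤z , z≤y)))
  ... | inj₁ x≤y | inj₂ z≤y | inj₂ z≤x = inj₁ (inj₂ (z≤x , x≤y))
  ... | inj₂ y≤x | inj₁ y≤z | inj₁ x≤z = inj₁ (inj₁ (y≤x , x≤z))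
  ... | inj₂ y≤x | inj₁ y≤z | inj₂ z≤x = inj₂ (inj₂ (inj₂ (y≤z , z≤x)))
  ... | inj₂ y≤x | inj₂ z≤y | _        = inj₂ (inj₁ (inj₂ (z≤y , y≤x)))

  module _ {d : ℕ} where

    box : Point ℝ d → Point ℝ d → Region ℝ d
    box = Product ℝ

    replace : Point ℝ d → Fin d → Carrier → Point ℝ d
    replace p j x = updateAt p j (const x)

    replace-at : ∀ p j x → replace p j x j ≡ x
    replace-at p j x = updateAt-updates j p

    replace-∈ : ∀ {a b p j x} → p ∈ box a b → x ∈[ a j , b j ] → replace p j x ∈ box a b
    replace-∈ {a} {b} {p} {j} {x} p∈ x∈ i with i Fin.≟ j
    ... | yes ≡.refl = ≡.subst _∈[ a j , b j ] (≡.sym (replace-at p j x)) x∈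
    ... | no  i≢j    = ≡.subst _∈[ a i , b i ] (≡.sym (updateAt-minimal i j p i≢j)) (p∈ i)

    replace-∉ : ∀ {a b p i j x} → ¬ p i ∈[ a i , b i ] → i ≢ j → replace p j x ∉ box a b
    replace-∉ {a} {b} {p} {i} {j} p∉ i≢j ∈box =
      p∉ (≡.subst _∈[ a i , b i ] (updateAt-minimal i j p i≢j) (∈box i))

    replaced-∉ : ∀ {a b p j x} → ¬ x ∈[ a j , b j ] → replace p j x ∉ box a b
    replaced-∉ {a} {b} {p} {j} {x} x∉ ∈box = x∉ (≡.subst _∈[ a j , b j ] (replace-at p j x) (∈box j))

    ∉box : ∀ {a b p} → p ∉ box a b → ∃[ i ] ¬ p i ∈[ a i , b i ]
    ∉box p∉ = Fin.¬∀⟶∃¬ d _ (λ _ → em) p∉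

    module _ {a₁ b₁ a₂ b₂ a₃ b₃ p q r : Point ℝ d}
             (q∈₁ : q ∈ box a₁ b₁) (r∈₁ : r ∈ box a₁ b₁)
             (p∈₂ : p ∈ box a₂ b₂) (q∈₂ : q ∈ box a₂ b₂)
             (p∈₃ : p ∈ box a₃ b₃) (r∈₃ : r ∈ box a₃ b₃) where

      -- The coordinatewise median.
      helly : ∃[ m ] m ∈ box a₁ b₁ × m ∈ box a₂ b₂ × m ∈ box a₃ b₃
      helly = (λ i → proj₁ (median i)) , (λ i → proj₁ (proj₂ (median i))) ,
              (λ i → proj₁ (proj₂ (proj₂ (median i)))) , (λ i → proj₂ (proj₂ (proj₂ (median i))))
        where
        median : ∀ i → ∃[ m ] m ∈[ a₁ i , b₁ i ] × m ∈[ a₂ i , b₂ i ] × m ∈[ a₃ i , b₃ i ]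
        median i with some-between (p i) (q i) (r i)
        ... | inj₁ p-mid        = p i , between-convex (q∈₁ i) (r∈₁ i) p-mid , p∈₂ i , p∈₃ i
        ... | inj₂ (inj₁ q-mid) = q i , q∈₁ i , q∈₂ i , between-convex (p∈₃ i) (r∈₃ i) q-mid
        ... | inj₂ (inj₂ r-mid) = r i , r∈₁ i , between-convex (p∈₂ i) (q∈₂ i) r-mid , r∈₃ i

      -- If p, r and q miss the boxes 1, 2 and 3 in different coordinates, then p with a coordinate of
      -- q or r misses two of them; if only one coordinate is involved, betweenness is contradicted.
      escape : p ∉ box a₁ b₁ → r ∉ box a₂ b₂ → q ∉ box a₃ b₃ →
               (∃[ m ] m ∉ box a₁ b₁ × m ∈ box a₂ b₂ × m ∉ box a₃ b₃) ⊎
               (∃[ m ] m ∉ box a₁ b₁ × m ∉ box a₂ b₂ × m ∈ box a₃ b₃)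
      escape p∉₁ r∉₂ q∉₃ with i , pᵢ∉₁ ← ∉box p∉₁ | j , qⱼ∉₃ ← ∉box q∉₃ | k , rₖ∉₂ ← ∉box r∉₂
        with i Fin.≟ j | i Fin.≟ k
      ... | no i≢j     | _ = inj₁ (replace p j (q j) ,
              replace-∉ {a₁} {b₁} pᵢ∉₁ i≢j , replace-∈ {a₂} {b₂} p∈₂ (q∈₂ j) , replaced-∉ {a₃} {b₃} {p} qⱼ∉₃)
      ... | yes _      | no i≢k = inj₂ (replace p k (r k) ,
              replace-∉ {a₁} {b₁} pᵢ∉₁ i≢k , replaced-∉ {a₂} {b₂} {p} rₖ∉₂ , replace-∈ {a₃} {b₃} p∈₃ (r∈₃ k))
      ... | yes ≡.refl | yes ≡.refl with some-between (p i) (q i) (r i)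
      ...   | inj₁ p-mid        = contradiction (between-convex (q∈₁ i) (r∈₁ i) p-mid) pᵢ∉₁
      ...   | inj₂ (inj₁ q-mid) = contradiction (between-convex (p∈₃ i) (r∈₃ i) q-mid) qⱼ∉₃
      ...   | inj₂ (inj₂ r-mid) = contradiction (between-convex (p∈₂ i) (q∈₂ i) r-mid) rₖ∉₂

  box-with-point : ∀ {d} {U : Region ℝ d} {p} → IsBox ℝ U → p ∈ U → ∃[ a ] ∃[ b ] U ≐ Product ℝ a b
  box-with-point (inj₁ U-empty)           p∈U = ⊥-elim (U-empty _ p∈U)
  box-with-point (inj₂ (a , b , _ , U≐)) _   = a , b , U≐

  -- `p`, `q` and `r` have the words 23, 12 and 13. Medians give the first conclusion, which fails
  -- for `C₃`; exchanging a coordinate gives the second, which fails for `C₁` and `C₂`.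
  box-convex-with-pairs : ∀ {𝒞 : Code 3} → BoxConvex ℝ 𝒞 →
                          𝒞 s12 → 𝒞 s13 → 𝒞 s23 → 𝒞 s123 × (𝒞 s2 ⊎ 𝒞 s3)
  box-convex-with-pairs {𝒞} (d , _ , U , _ , U-box , word⇒ , ⇐word) c₁₂ c₁₃ c₂₃
    with p , p∈ ← point-of {U = U} (⇐word c₂₃)
       | q , q∈ ← point-of {U = U} (⇐word c₁₂)
       | r , r∈ ← point-of {U = U} (⇐word c₁₃)
    with a₁ , b₁ , to₁ , of₁ ← box-with-point (U-box 0F) (true-of (q∈ 0F))
       | a₂ , b₂ , to₂ , of₂ ← box-with-point (U-box 1F) (true-of (p∈ 1F))
       | a₃ , b₃ , to₃ , of₃ ← box-with-point (U-box 2F) (true-of (p∈ 2F))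
    = let m , m∈₁ , m∈₂ , m∈₃ = helly q∈₁ r∈₁ p∈₂ q∈₂ p∈₃ r∈₃
      in occurs m (∀₃ (ofʸ (of₁ m∈₁)) (ofʸ (of₂ m∈₂)) (ofʸ (of₃ m∈₃))) ,
         [ (λ (m , m∉₁ , m∈₂ , m∉₃) → inj₁ (occurs m (∀₃ (ofⁿ (m∉₁ ∘ to₁)) (ofʸ (of₂ m∈₂)) (ofⁿ (m∉₃ ∘ to₃)))))
         , (λ (m , m∉₁ , m∉₂ , m∈₃) → inj₂ (occurs m (∀₃ (ofⁿ (m∉₁ ∘ to₁)) (ofⁿ (m∉₂ ∘ to₂)) (ofʸ (of₃ m∈₃)))))
         ]′ (escape q∈₁ r∈₁ p∈₂ q∈₂ p∈₃ r∈₃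
              (false-of (p∈ 0F) ∘ of₁) (false-of (r∈ 1F) ∘ of₂) (false-of (q∈ 2F) ∘ of₃))
    where
    q∈₁ = to₁ (true-of (q∈ 0F))
    r∈₁ = to₁ (true-of (r∈ 0F))
    p∈₂ = to₂ (true-of (p∈ 1F))
    q∈₂ = to₂ (true-of (q∈ 1F))
    p∈₃ = to₃ (true-of (p∈ 2F))
    r∈₃ = to₃ (true-of (r∈ 2F))

    occurs : ∀ p {σ} → (∀ i → Reflects (p ∈ U i) (lookup σ i)) → 𝒞 σ
    occurs p r = word⇒ (word-at {U = U} {p} r)

  -- Polygons are closed, convex and bounded.

  lattice-point : ℕ → ℕ → Point ℝ 2
  lattice-point m n 0F = ι m
  lattice-point m n 1F = ι n

  coordinates : Point ℝ 2 → Fin 3 → Carrier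
  coordinates p = ∀₃ (p 0F) (p 1F) (p 0F + p 1F)

  Holds : Point ℝ 2 → Constraint → Set
  Holds p (i ≼ k) = coordinates p i ≤ ι k
  Holds p (i ≽ k) = ι k ≤ coordinates p i

  ⟦_⟧ : Polygon → Region ℝ 2
  ⟦ P ⟧ p = All (Holds p) (triangle P)

  coordinates-lattice : ∀ m n i → coordinates (lattice-point m n) i ≈ ι (coordinatesᴺ m n i)
  coordinates-lattice m n 0F = refl
  coordinates-lattice m n 1F = refl
  coordinates-lattice m n 2F = sym (ι-+ m n)

  holds-lattice : ∀ {m n} c → Holds (lattice-point m n) c ⇔ Holdsᴺ m n c
  holds-lattice {m} {n} (i ≼ k) = mk⇔
    (to (ι-≤⇔ _ _) ∘ ≤-respˡ-≈ (coordinates-lattice m n i))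
    (≤-respˡ-≈ (sym (coordinates-lattice m n i)) ∘ from (ι-≤⇔ _ _))
  holds-lattice {m} {n} (i ≽ k) = mk⇔
    (to (ι-≤⇔ _ _) ∘ ≤-respʳ-≈ (coordinates-lattice m n i))
    (≤-respʳ-≈ (sym (coordinates-lattice m n i)) ∘ from (ι-≤⇔ _ _))

  -- Membership of lattice points is evaluated in ℕ, so naming a lattice point suffices to show that
  -- a word occurs.
  contains-reflects : ∀ P m n → Reflects (lattice-point m n ∈ ⟦ P ⟧) (contains P m n)
  contains-reflects P m n = proof (Dec.map′ (All.map (from (holds-lattice _))) (All.map (to (holds-lattice _)))
    (All.all? (holdsᴺ? m n) (triangle P)))

  coordinates-affine : ∀ t p q i →
    coordinates (segment p q t) i ≈ t * coordinates p i + (1# - t) * coordinates q i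
  coordinates-affine t p q 0F = refl
  coordinates-affine t p q 1F = refl
  coordinates-affine t p q 2F = solve 6
    (λ t t′ a b c d → t :* a :+ t′ :* b :+ (t :* c :+ t′ :* d) := t :* (a :+ c) :+ t′ :* (b :+ d))
    refl t (1# - t) (p 0F) (q 0F) (p 1F) (q 1F)

  mixture : ∀ t x → t * x + (1# - t) * x ≈ x
  mixture t x = solve 2 (λ t x → t :* x :+ (con (+ 1) :- t) :* x := x) refl t x

  mixture-mono : ∀ {t x x′ y y′} → 0# ≤ t → t ≤ 1# → x ≤ x′ → y ≤ y′ →
                 t * x + (1# - t) * y ≤ t * x′ + (1# - t) * y′
  mixture-mono 0≤t t≤1 x≤x′ y≤y′ = +-mono-≤ (*-monoʳ-≤ 0≤t x≤x′) (*-monoʳ-≤ (≤⇒0≤- t≤1) y≤y′)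

  holds-convex : ∀ {p q t} c → 0# ≤ t → t ≤ 1# → Holds p c → Holds q c → Holds (segment p q t) c
  holds-convex {p} {q} {t} (i ≼ k) 0≤t t≤1 hp hq = ≤-respˡ-≈ (sym (coordinates-affine t p q i))
    (≤-respʳ-≈ (mixture t (ι k)) (mixture-mono 0≤t t≤1 hp hq))
  holds-convex {p} {q} {t} (i ≽ k) 0≤t t≤1 hp hq = ≤-respʳ-≈ (sym (coordinates-affine t p q i))
    (≤-respˡ-≈ (mixture t (ι k)) (mixture-mono 0≤t t≤1 hp hq))

  polygon-convex : ∀ P → IsConvex ℝ ⟦ P ⟧
  polygon-convex P {p} {q} p∈ q∈ t 0≤t t≤1 =
    All.zipWith (λ {c} (hp , hq) → holds-convex {p} {q} {t} c 0≤t t≤1 hp hq) (p∈ , q∈)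

  -- When `x` and `y` each move by less than `h`, their sum moves by less than `h + h`; this margin
  -- is used for all three quantities.
  coordinates-near : ∀ {p q h} → 0# < h → q ∈ Cube ℝ p h → ∀ i →
    coordinates p i < coordinates q i + (h + h) × coordinates q i < coordinates p i + (h + h)
  coordinates-near {p} {q} {h} 0<h q∈cube = ∀₃ (near 0F) (near 1F)
    ( <-respʳ-≈ (rearrange _ _) (+-mono-< (below 0F) (below 1F))
    , <-respʳ-≈ (rearrange _ _) (+-mono-< (above 0F) (above 1F)))
    where
    below : ∀ i → p i < q i + h
    below i = -‿<⁻ (proj₁ (q∈cube i))

    above : ∀ i → q i < p i + h
    above i = proj₂ (q∈cube i)

    widen : ∀ x → x + h ≤ x + (h + h)
    widen x = ≤-by (<⇒≤ 0<h) (sym (+-assoc x h h))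

    near : ∀ i → p i < q i + (h + h) × q i < p i + (h + h)
    near i = <-≤-trans (below i) (widen _) , <-≤-trans (above i) (widen _)

    rearrange : ∀ x y → x + h + (y + h) ≈ x + y + (h + h)
    rearrange x y = solve 3 (λ x y h → x :+ h :+ (y :+ h) := x :+ y :+ (h :+ h)) refl x y h

  halve : ∀ {ε} → 0# < ε → ∃[ h ] 0# < h × h + h ≈ ε
  halve {ε} 0<ε =
    let h , 0<h , 2h≈ε = divide (+-nonNeg-pos 0≤1 0<1) 0<ε in
    h , 0<h , trans (solve 1 (λ h → h :+ h := (con (+ 1) :+ con (+ 1)) :* h) refl h) 2h≈ε

  gap : ∀ {x y h} → h + h ≈ y - x → x + (h + h) ≈ y
  gap {x} {y} 2h≈ = trans (+-congˡ 2h≈) (solve 2 (λ x y → x :+ (y :- x) := y) refl x y)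

  -- The radius is half the amount by which the constraint fails, so no point of the cube can make
  -- up for the failure.
  violated-open : ∀ c → IsOpen ℝ (λ p → ¬ Holds p c)
  violated-open (i ≼ k) {p} p∉ =
    let h , 0<h , 2h≈ = halve (<⇒0<- (≰⇒> p∉)) in
    h , 0<h , λ {q} q∈cube q∈ → <⇒≱ (proj₁ (coordinates-near {p} {q} 0<h q∈cube i))
      (≤-respʳ-≈ (gap 2h≈) (+-mono-≤ q∈ ≤-refl))
  violated-open (i ≽ k) {p} p∉ =
    let h , 0<h , 2h≈ = halve (<⇒0<- (≰⇒> p∉)) in
    h , 0<h , λ {q} q∈cube q∈ → <⇒≱ (proj₂ (coordinates-near {p} {q} 0<h q∈cube i))
      (≤-respˡ-≈ (sym (gap 2h≈)) q∈)

  -- A point outside violates a single constraint, and so do all points near it.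
  polygon-closed : ∀ P → IsClosed ℝ ⟦ P ⟧
  polygon-closed P p∉ =
    let c , c∈P , violated = find (¬All⇒Any¬ (λ _ → em) (triangle P) p∉)
        ε , 0<ε , ball = violated-open c violated
    in ε , 0<ε , λ q∈cube q∈ → ball q∈cube (All.lookup q∈ c∈P)

  -ι≤0 : ∀ n → - ι n ≤ 0#
  -ι≤0 n = ≤-by (0≤ι n) (sym (-‿inverseˡ (ι n)))

  polygon-bounded : ∀ P → IsBounded ℝ ⟦ P ⟧
  polygon-bounded P = ι 5 , λ { (0≤x ∷ 0≤y ∷ x+y≤5 ∷ _) → λ where
    0F → ≤-trans (-ι≤0 5) 0≤x , ≤-trans (≤-by 0≤y refl) x+y≤5
    1F → ≤-trans (-ι≤0 5) 0≤y , ≤-trans (≤-by 0≤x (+-comm _ _)) x+y≤5 }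

  -- Closed convex realizations of `C₁`, `C₂` and `C₃`.

  lattice-word : ∀ (P : Fin 3 → Polygon) m n →
    code ℝ (⟦_⟧ ∘ P) (contains (P 0F) m n ∷ contains (P 1F) m n ∷ contains (P 2F) m n ∷ [])
  lattice-word P m n = word-at {U = ⟦_⟧ ∘ P} (∀₃
    (contains-reflects (P 0F) m n) (contains-reflects (P 1F) m n) (contains-reflects (P 2F) m n))

  polygons-convex : ∀ (L : List (Subset 3)) (P : Fin 3 → Polygon) →
    (∀ {σ} → code ℝ (⟦_⟧ ∘ P) σ → σ ∈ˡ L) → All (code ℝ (⟦_⟧ ∘ P)) L → Convex ℝ (_∈ˡ L)
  polygons-convex L P words occurring = inj₂ (2 , ℕ.z<s , ⟦_⟧ ∘ P , polygon-bounded ∘ P ,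
    (λ i → polygon-closed (P i) , polygon-convex (P i)) , words , All.lookup occurring)

  -- Three polygons cut from the triangle 1 ≤ x, 0 ≤ y, x + y ≤ 5 by x ≤ 3, y ≤ 2 and 3 ≤ x + y:
  -- of these inequalities no two fail at once.
  P₂ P₃ : Polygon
  P₂ = 0F ≽ 1 ∷ 1F ≼ 2 ∷ []
  P₃ = 0F ≽ 1 ∷ 2F ≽ 3 ∷ []

  module _ {p : Point ℝ 2} where

    only-first : p ∈ ⟦ 0F ≽ 1 ∷ [] ⟧ → p ∉ ⟦ P₂ ⟧ → p ∉ ⟦ P₃ ⟧ → Absurd
    only-first (0≤x ∷ 0≤y ∷ s≤5 ∷ 1≤x ∷ []) p∉₂ p∉₃ =
      <⇒≱ s<3 (≤-respˡ-≈ (sym (ι-+ 1 2)) (+-mono-≤ 1≤x (<⇒≤ 2<y)))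
      where
      2<y = ≰⇒> λ y≤2 → p∉₂ (0≤x ∷ 0≤y ∷ s≤5 ∷ 1≤x ∷ y≤2 ∷ [])
      s<3 = ≰⇒> λ 3≤s → p∉₃ (0≤x ∷ 0≤y ∷ s≤5 ∷ 1≤x ∷ 3≤s ∷ [])

    only-second : ¬ p 0F ≤ ι 3 → p ∈ ⟦ P₂ ⟧ → p ∉ ⟦ P₃ ⟧ → Absurd
    only-second x≰3 (0≤x ∷ 0≤y ∷ s≤5 ∷ 1≤x ∷ y≤2 ∷ []) p∉₃ =
      p∉₃ (0≤x ∷ 0≤y ∷ s≤5 ∷ 1≤x ∷ ≤-trans (<⇒≤ (≰⇒> x≰3)) (≤-by 0≤y refl) ∷ [])

    only-third : ¬ p 0F ≤ ι 3 → p ∈ ⟦ P₃ ⟧ → p ∉ ⟦ P₂ ⟧ → Absurd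
    only-third x≰3 (0≤x ∷ 0≤y ∷ s≤5 ∷ 1≤x ∷ 3≤s ∷ []) p∉₂ =
      <⇒≱ (+-mono-< (≰⇒> x≰3) (≰⇒> y≰2)) (≤-respʳ-≈ (ι-+ 3 2) s≤5)
      where
      y≰2 : ¬ p 1F ≤ ι 2
      y≰2 y≤2 = p∉₂ (0≤x ∷ 0≤y ∷ s≤5 ∷ 1≤x ∷ y≤2 ∷ [])

  C₁-convex : Convex ℝ C₁
  C₁-convex = polygons-convex _ P words
    -- Witnesses in the order of the words; (9,9) lies outside the triangle and so gives `∅`.
    (lattice-word P 2 1 ∷ lattice-word P 1 0 ∷ lattice-word P 1 3 ∷ lattice-word P 4 0 ∷ lattice-word P 9 9 ∷ [])
    where
    P₁ = 0F ≽ 1 ∷ 0F ≼ 3 ∷ []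

    P : Fin 3 → Polygon
    P = ∀₃ P₁ P₂ P₃

    x≰3 : ∀ {p} → p ∉ ⟦ P₁ ⟧ → p ∈ ⟦ 0F ≽ 1 ∷ [] ⟧ → ¬ p 0F ≤ ι 3
    x≰3 p∉₁ (0≤x ∷ 0≤y ∷ s≤5 ∷ 1≤x ∷ []) x≤3 = p∉₁ (0≤x ∷ 0≤y ∷ s≤5 ∷ 1≤x ∷ x≤3 ∷ [])

    right-of-1 : ∀ {p c} → p ∈ ⟦ 0F ≽ 1 ∷ c ∷ [] ⟧ → p ∈ ⟦ 0F ≽ 1 ∷ [] ⟧
    right-of-1 (0≤x ∷ 0≤y ∷ s≤5 ∷ 1≤x ∷ _) = 0≤x ∷ 0≤y ∷ s≤5 ∷ 1≤x ∷ []

    words : ∀ {σ} → code ℝ (⟦_⟧ ∘ P) σ → C₁ σ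
    words {true ∷ true ∷ true ∷ []}    w = here ≡.refl
    words {true ∷ true ∷ false ∷ []}   w = there (here ≡.refl)
    words {true ∷ false ∷ true ∷ []}   w = there (there (here ≡.refl))
    words {false ∷ true ∷ true ∷ []}   w = there (there (there (here ≡.refl)))
    words {false ∷ false ∷ false ∷ []} w = there (there (there (there (here ≡.refl))))
    words {true ∷ false ∷ false ∷ []}  w = let p , r = point-of {U = ⟦_⟧ ∘ P} w in
      ⊥-elim (only-first (right-of-1 (true-of (r 0F))) (false-of (r 1F)) (false-of (r 2F)))
    words {false ∷ true ∷ false ∷ []}  w = let p , r = point-of {U = ⟦_⟧ ∘ P} w ; p∈₂ = true-of (r 1F) in
      ⊥-elim (only-second (x≰3 (false-of (r 0F)) (right-of-1 p∈₂)) p∈₂ (false-of (r 2F)))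
    words {false ∷ false ∷ true ∷ []}  w = let p , r = point-of {U = ⟦_⟧ ∘ P} w ; p∈₃ = true-of (r 2F) in
      ⊥-elim (only-third (x≰3 (false-of (r 0F)) (right-of-1 p∈₃)) p∈₃ (false-of (r 1F)))

  C₂-convex : Convex ℝ C₂
  C₂-convex = polygons-convex _ P words
    (lattice-word P 2 1 ∷ lattice-word P 1 0 ∷ lattice-word P 1 3 ∷ lattice-word P 4 0 ∷
     lattice-word P 0 0 ∷ lattice-word P 9 9 ∷ [])
    where
    -- Only the first polygon drops `x ≥ 1`, so the strip `0 ≤ x < 1` of the triangle belongs to it
    -- alone and the origin has the word 1.
    P₁ = 0F ≼ 3 ∷ []

    P : Fin 3 → Polygon
    P = ∀₃ P₁ P₂ P₃

    x≰3 : ∀ {p Q} → p ∉ ⟦ P₁ ⟧ → p ∈ ⟦ Q ⟧ → ¬ p 0F ≤ ι 3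
    x≰3 p∉₁ (0≤x ∷ 0≤y ∷ s≤5 ∷ _) x≤3 = p∉₁ (0≤x ∷ 0≤y ∷ s≤5 ∷ x≤3 ∷ [])

    words : ∀ {σ} → code ℝ (⟦_⟧ ∘ P) σ → C₂ σ
    words {true ∷ true ∷ true ∷ []}    w = here ≡.refl
    words {true ∷ true ∷ false ∷ []}   w = there (here ≡.refl)
    words {true ∷ false ∷ true ∷ []}   w = there (there (here ≡.refl))
    words {false ∷ true ∷ true ∷ []}   w = there (there (there (here ≡.refl)))
    words {true ∷ false ∷ false ∷ []}  w = there (there (there (there (here ≡.refl))))
    words {false ∷ false ∷ false ∷ []} w = there (there (there (there (there (here ≡.refl)))))
    words {false ∷ true ∷ false ∷ []}  w = let p , r = point-of {U = ⟦_⟧ ∘ P} w ; p∈₂ = true-of (r 1F) in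
      ⊥-elim (only-second (x≰3 (false-of (r 0F)) p∈₂) p∈₂ (false-of (r 2F)))
    words {false ∷ false ∷ true ∷ []}  w = let p , r = point-of {U = ⟦_⟧ ∘ P} w ; p∈₃ = true-of (r 2F) in
      ⊥-elim (only-third (x≰3 (false-of (r 0F)) p∈₃) p∈₃ (false-of (r 1F)))

  -- The three edges of a triangle.
  C₃-convex : Convex ℝ C₃
  C₃-convex = polygons-convex _ P words
    (lattice-word P 0 0 ∷ lattice-word P 5 0 ∷ lattice-word P 0 5 ∷
     lattice-word P 1 0 ∷ lattice-word P 0 1 ∷ lattice-word P 1 4 ∷ lattice-word P 1 1 ∷ [])
    where
    P : Fin 3 → Polygon
    P = ∀₃ (1F ≼ 0 ∷ []) (0F ≼ 0 ∷ []) (2F ≽ 5 ∷ [])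

    no-common-point : ∀ {p} → p ∈ ⟦ P 0F ⟧ → p ∈ ⟦ P 1F ⟧ → p ∈ ⟦ P 2F ⟧ → Absurd
    no-common-point (_ ∷ _ ∷ _ ∷ y≤0 ∷ []) (_ ∷ _ ∷ _ ∷ x≤0 ∷ []) (_ ∷ _ ∷ _ ∷ 5≤s ∷ []) =
      <⇒≱ (ι-mono-< {0} {5} ℕ.z<s) (≤-trans 5≤s (≤-respʳ-≈ (+-identityˡ 0#) (+-mono-≤ x≤0 y≤0)))

    words : ∀ {σ} → code ℝ (⟦_⟧ ∘ P) σ → C₃ σ
    words {true ∷ true ∷ false ∷ []}   w = here ≡.refl
    words {true ∷ false ∷ true ∷ []}   w = there (here ≡.refl)
    words {false ∷ true ∷ true ∷ []}   w = there (there (here ≡.refl))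
    words {true ∷ false ∷ false ∷ []}  w = there (there (there (here ≡.refl)))
    words {false ∷ true ∷ false ∷ []}  w = there (there (there (there (here ≡.refl))))
    words {false ∷ false ∷ true ∷ []}  w = there (there (there (there (there (here ≡.refl)))))
    words {false ∷ false ∷ false ∷ []} w = there (there (there (there (there (there (here ≡.refl))))))
    words {true ∷ true ∷ true ∷ []}    w = let p , r = point-of {U = ⟦_⟧ ∘ P} w in
      ⊥-elim (no-common-point (true-of (r 0F)) (true-of (r 1F)) (true-of (r 2F)))

  -- Codes of boxes, computed from cells.

  Agree : Carrier → ℕ → ℕ → Set
  Agree x g e = (ι e ≤ x ⇔ e ℕ.≤ g) × (x ≤ ι e ⇔ g ℕ.≤ e)

  -- For the cut points `odd k`, `Agree` says that `x` lies in cell `g`. By induction on the number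
  -- of cut points, `x` is compared with the last one: before it the smaller case applies, at it the
  -- cell is `odd m`, beyond it the next one.
  cell-of : ∀ m x → ∃[ g ] g ℕ.< odd m × (∀ k → k ℕ.< m → Agree x g (odd k))
  cell-of zero    x = 0 , ℕ.z<s , λ _ ()
  cell-of (suc m) x with em {ι (odd m) ≤ x} | em {x ≤ ι (odd m)}
  ... | no e≰x | _ = let g , g<e , agree = cell-of m x in
    g , ℕ.<-trans g<e (odd-mono-< (ℕ.n<1+n m)) , λ k k<1+m → [ agree k , (λ { ≡.refl →
      mk⇔ (⊥-elim ∘ e≰x) (λ e≤g → contradiction e≤g (ℕ.<⇒≱ g<e)) ,
      mk⇔ (λ _ → ℕ.<⇒≤ g<e) (λ _ → <⇒≤ (≰⇒> e≰x)) }) ]′ (ℕ.m<1+n⇒m<n∨m≡n k<1+m)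
  ... | yes e≤x | yes x≤e = odd m , odd-mono-< (ℕ.n<1+n m) , λ k _ →
    mk⇔ (λ k≤x → to (ι-≤⇔ _ _) (≤-trans k≤x x≤e)) (λ k≤e → ≤-trans (ι-mono-≤ k≤e) e≤x) ,
    mk⇔ (λ x≤k → to (ι-≤⇔ _ _) (≤-trans e≤x x≤k)) (λ e≤k → ≤-trans x≤e (ι-mono-≤ e≤k))
  ... | yes e≤x | no x≰e = suc (odd m) , ℕ.s<s (ℕ.s<s (ℕ.+-monoʳ-< m (ℕ.n<1+n m))) , λ k k<1+m →
    let k≤e = odd-mono (ℕ.m<1+n⇒m≤n k<1+m) in
    mk⇔ (λ _ → ℕ.m≤n⇒m≤1+n k≤e) (λ _ → ≤-trans (ι-mono-≤ k≤e) e≤x) ,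
    mk⇔ (λ x≤k → contradiction (≤-trans x≤k (ι-mono-≤ k≤e)) x≰e) (λ e<k → contradiction k≤e (ℕ.<⇒≱ e<k))

  -- The integer `g` lies in cell `g` and so can represent it.
  agree-lattice : ∀ g e → Agree (ι g) g e
  agree-lattice g e = ι-≤⇔ e g , ι-≤⇔ g e

  lower-left upper-right : Box → Point ℝ 2
  lower-left  [ l ⋯ r ]×[ b ⋯ t ] = lattice-point (odd (toℕ l)) (odd (toℕ b))
  upper-right [ l ⋯ r ]×[ b ⋯ t ] = lattice-point (odd (toℕ r)) (odd (toℕ t))

  realBox : Box → Region ℝ 2
  realBox B = Product ℝ (lower-left B) (upper-right B)

  -- A product with a reversed side is empty, and the empty set also counts as a box.
  Product-isBox : ∀ {d} (a b : Point ℝ d) → IsBox ℝ (Product ℝ a b)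
  Product-isBox a b with em {Satisfiable (Product ℝ a b)}
  ... | yes (p , p∈) = inj₂ (a , b , (λ i → ≤-trans (proj₁ (p∈ i)) (proj₂ (p∈ i))) , id , id)
  ... | no  empty    = inj₁ λ p p∈ → empty (p , p∈)

  realBox-bounded : ∀ B → IsBounded ℝ (realBox B)
  realBox-bounded [ l ⋯ r ]×[ b ⋯ t ] = ι 5 , λ p∈ → λ where
      0F → bound l r (p∈ 0F)
      1F → bound b t (p∈ 1F)
    where
    bound : ∀ (k u : Fin 3) {x} → (ι (odd (toℕ k)) ≤ x) × (x ≤ ι (odd (toℕ u))) → (- ι 5 ≤ x) × (x ≤ ι 5)
    bound k u (k≤x , x≤u) = ≤-trans (-ι≤0 5) (≤-trans (0≤ι (odd (toℕ k))) k≤x) ,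
      ≤-trans x≤u (ι-mono-≤ (odd-mono (Fin.toℕ≤pred[n] u)))

  realBox⇔InCell : ∀ B {p g h} → (∀ (k : Fin 3) → Agree (p 0F) g (odd (toℕ k))) →
    (∀ (k : Fin 3) → Agree (p 1F) h (odd (toℕ k))) → p ∈ realBox B ⇔ InCell B g h
  realBox⇔InCell [ l ⋯ r ]×[ b ⋯ t ] x~g y~h = mk⇔
    (λ p∈ → (to (proj₁ (x~g l)) (proj₁ (p∈ 0F)) , to (proj₂ (x~g r)) (proj₂ (p∈ 0F))) ,
            (to (proj₁ (y~h b)) (proj₁ (p∈ 1F)) , to (proj₂ (y~h t)) (proj₂ (p∈ 1F))))
    λ ((l≤ , ≤r) , (b≤ , ≤t)) → λ where
      0F → from (proj₁ (x~g l)) l≤ , from (proj₂ (x~g r)) ≤r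
      1F → from (proj₁ (y~h b)) b≤ , from (proj₂ (y~h t)) ≤t

  module _ (Bs : Vec Box 3) where

    private
      U : Fin 3 → Region ℝ 2
      U = realBox ∘ lookup Bs

    cell-word-at : ∀ {p g h} → (∀ (k : Fin 3) → Agree (p 0F) g (odd (toℕ k))) →
      (∀ (k : Fin 3) → Agree (p 1F) h (odd (toℕ k))) → ∀ i → p ∈ U i ⇔ i ∈ˢ cell-word Bs g h
    cell-word-at {p} {g} {h} x~g y~h i = Reflects⇒∈⇔ (cell-word Bs g h) (≡.subst (Reflects _)
      (≡.sym (lookup-map i _ Bs)) (proof (Dec.map (⇔-sym (realBox⇔InCell (lookup Bs i) x~g y~h)) (inCell? (lookup Bs i) g h))))

    -- A point has the same word as its cell, which is one of 49; conversely, each cell is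
    -- represented by an integer point.
    code-of-boxes : code ℝ U ≐ (_∈ˡ cell-words Bs)
    code-of-boxes = ⊆cells , cells⊆
      where
      ⊆cells : ∀ {σ} → code ℝ U σ → σ ∈ˡ cell-words Bs
      ⊆cells (p , p∈) =
        let g , g<7 , x~g = cell-of 3 (p 0F)
            h , h<7 , y~h = cell-of 3 (p 1F)
        in ≡.subst (_∈ˡ cell-words Bs)
             (word-unique (cell-word-at (λ k → x~g _ (Fin.toℕ<n k)) (λ k → y~h _ (Fin.toℕ<n k))) p∈)
             (∈-cartesianProductWith⁺ (cell-word Bs) (∈-upTo⁺ g<7) (∈-upTo⁺ h<7))

      cells⊆ : ∀ {σ} → σ ∈ˡ cell-words Bs → code ℝ U σ
      cells⊆ σ∈ with g , h , _ , _ , ≡.refl ← ∈-cartesianProductWith⁻ (cell-word Bs) (upTo 7) (upTo 7) σ∈ =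
        lattice-point g h , cell-word-at (λ _ → agree-lattice g _) (λ _ → agree-lattice h _)

    boxes-boxConvex : ∀ {𝒞 : Code 3} → 𝒞 ≐ (_∈ˡ cell-words Bs) → BoxConvex ℝ 𝒞
    boxes-boxConvex (𝒞⊆ , ⊆𝒞) = 2 , ℕ.z<s , U , realBox-bounded ∘ lookup Bs ,
      (λ i → Product-isBox _ _) , ⊆𝒞 ∘ proj₁ code-of-boxes , proj₂ code-of-boxes ∘ 𝒞⊆

-- Enumeration of the codes on three indices.

open DecMembership (Vec.≡-dec {n = 3} Bool._≟_) using () renaming (_∈?_ to _∈ˡ?_)

orderings : ∀ {A : Set} → Vec A 3 → List (Vec A 3)
orderings (a ∷ b ∷ c ∷ []) =
  (a ∷ b ∷ c ∷ []) ∷ (a ∷ c ∷ b ∷ []) ∷ (b ∷ a ∷ c ∷ []) ∷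
  (b ∷ c ∷ a ∷ []) ∷ (c ∷ a ∷ b ∷ []) ∷ (c ∷ b ∷ a ∷ []) ∷ []

-- Found by search: one triple for each box-convex code up to permutation. An interval 1 ⋯ 0 is empty.
arrangements : List (Vec Box 3)
arrangements =
  ([ 1F ⋯ 0F ]×[ 0F ⋯ 0F ] ∷ [ 1F ⋯ 0F ]×[ 0F ⋯ 0F ] ∷ [ 1F ⋯ 0F ]×[ 0F ⋯ 0F ] ∷ []) ∷
  ([ 1F ⋯ 0F ]×[ 0F ⋯ 0F ] ∷ [ 1F ⋯ 0F ]×[ 0F ⋯ 0F ] ∷ [ 0F ⋯ 0F ]×[ 0F ⋯ 0F ] ∷ []) ∷
  ([ 1F ⋯ 0F ]×[ 0F ⋯ 0F ] ∷ [ 0F ⋯ 0F ]×[ 0F ⋯ 0F ] ∷ [ 0F ⋯ 0F ]×[ 0F ⋯ 0F ] ∷ []) ∷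
  ([ 0F ⋯ 0F ]×[ 0F ⋯ 0F ] ∷ [ 0F ⋯ 0F ]×[ 0F ⋯ 0F ] ∷ [ 0F ⋯ 0F ]×[ 0F ⋯ 0F ] ∷ []) ∷
  ([ 1F ⋯ 0F ]×[ 0F ⋯ 0F ] ∷ [ 0F ⋯ 0F ]×[ 0F ⋯ 0F ] ∷ [ 1F ⋯ 1F ]×[ 0F ⋯ 0F ] ∷ []) ∷
  ([ 1F ⋯ 0F ]×[ 0F ⋯ 0F ] ∷ [ 0F ⋯ 0F ]×[ 0F ⋯ 0F ] ∷ [ 0F ⋯ 1F ]×[ 0F ⋯ 0F ] ∷ []) ∷
  ([ 0F ⋯ 0F ]×[ 0F ⋯ 0F ] ∷ [ 0F ⋯ 0F ]×[ 0F ⋯ 0F ] ∷ [ 1F ⋯ 1F ]×[ 0F ⋯ 0F ] ∷ []) ∷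
  ([ 0F ⋯ 0F ]×[ 0F ⋯ 0F ] ∷ [ 0F ⋯ 0F ]×[ 0F ⋯ 0F ] ∷ [ 0F ⋯ 1F ]×[ 0F ⋯ 0F ] ∷ []) ∷
  ([ 0F ⋯ 0F ]×[ 0F ⋯ 0F ] ∷ [ 0F ⋯ 1F ]×[ 0F ⋯ 0F ] ∷ [ 0F ⋯ 1F ]×[ 0F ⋯ 0F ] ∷ []) ∷
  ([ 1F ⋯ 0F ]×[ 0F ⋯ 0F ] ∷ [ 0F ⋯ 1F ]×[ 0F ⋯ 0F ] ∷ [ 1F ⋯ 2F ]×[ 0F ⋯ 0F ] ∷ []) ∷
  ([ 0F ⋯ 0F ]×[ 0F ⋯ 0F ] ∷ [ 1F ⋯ 1F ]×[ 0F ⋯ 0F ] ∷ [ 2F ⋯ 2F ]×[ 0F ⋯ 0F ] ∷ []) ∷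
  ([ 0F ⋯ 0F ]×[ 0F ⋯ 0F ] ∷ [ 0F ⋯ 1F ]×[ 0F ⋯ 0F ] ∷ [ 2F ⋯ 2F ]×[ 0F ⋯ 0F ] ∷ []) ∷
  ([ 0F ⋯ 1F ]×[ 0F ⋯ 0F ] ∷ [ 1F ⋯ 1F ]×[ 0F ⋯ 0F ] ∷ [ 1F ⋯ 2F ]×[ 0F ⋯ 0F ] ∷ []) ∷
  ([ 0F ⋯ 0F ]×[ 0F ⋯ 0F ] ∷ [ 0F ⋯ 1F ]×[ 0F ⋯ 0F ] ∷ [ 1F ⋯ 1F ]×[ 0F ⋯ 0F ] ∷ []) ∷
  ([ 0F ⋯ 0F ]×[ 0F ⋯ 0F ] ∷ [ 0F ⋯ 1F ]×[ 0F ⋯ 0F ] ∷ [ 0F ⋯ 2F ]×[ 0F ⋯ 0F ] ∷ []) ∷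
  ([ 0F ⋯ 1F ]×[ 0F ⋯ 0F ] ∷ [ 0F ⋯ 1F ]×[ 0F ⋯ 0F ] ∷ [ 1F ⋯ 2F ]×[ 0F ⋯ 0F ] ∷ []) ∷
  ([ 0F ⋯ 1F ]×[ 0F ⋯ 0F ] ∷ [ 0F ⋯ 2F ]×[ 0F ⋯ 0F ] ∷ [ 1F ⋯ 2F ]×[ 0F ⋯ 0F ] ∷ []) ∷
  ([ 0F ⋯ 0F ]×[ 0F ⋯ 0F ] ∷ [ 0F ⋯ 1F ]×[ 0F ⋯ 0F ] ∷ [ 1F ⋯ 2F ]×[ 0F ⋯ 0F ] ∷ []) ∷
  ([ 0F ⋯ 0F ]×[ 0F ⋯ 0F ] ∷ [ 0F ⋯ 0F ]×[ 1F ⋯ 2F ] ∷ [ 0F ⋯ 1F ]×[ 1F ⋯ 1F ] ∷ []) ∷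
  ([ 0F ⋯ 0F ]×[ 0F ⋯ 0F ] ∷ [ 0F ⋯ 0F ]×[ 0F ⋯ 2F ] ∷ [ 0F ⋯ 1F ]×[ 0F ⋯ 1F ] ∷ []) ∷
  ([ 0F ⋯ 0F ]×[ 0F ⋯ 1F ] ∷ [ 0F ⋯ 0F ]×[ 1F ⋯ 2F ] ∷ [ 0F ⋯ 1F ]×[ 1F ⋯ 1F ] ∷ []) ∷
  ([ 0F ⋯ 0F ]×[ 0F ⋯ 1F ] ∷ [ 0F ⋯ 0F ]×[ 0F ⋯ 2F ] ∷ [ 0F ⋯ 1F ]×[ 0F ⋯ 0F ] ∷ []) ∷
  ([ 0F ⋯ 0F ]×[ 0F ⋯ 1F ] ∷ [ 0F ⋯ 1F ]×[ 0F ⋯ 0F ] ∷ [ 0F ⋯ 1F ]×[ 0F ⋯ 1F ] ∷ []) ∷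
  ([ 0F ⋯ 0F ]×[ 0F ⋯ 1F ] ∷ [ 0F ⋯ 0F ]×[ 0F ⋯ 2F ] ∷ [ 0F ⋯ 1F ]×[ 1F ⋯ 2F ] ∷ []) ∷
  ([ 0F ⋯ 0F ]×[ 0F ⋯ 1F ] ∷ [ 0F ⋯ 0F ]×[ 1F ⋯ 2F ] ∷ [ 0F ⋯ 1F ]×[ 0F ⋯ 0F ] ∷ []) ∷
  ([ 0F ⋯ 0F ]×[ 0F ⋯ 1F ] ∷ [ 0F ⋯ 1F ]×[ 1F ⋯ 2F ] ∷ [ 0F ⋯ 2F ]×[ 1F ⋯ 1F ] ∷ []) ∷
  ([ 0F ⋯ 0F ]×[ 0F ⋯ 2F ] ∷ [ 0F ⋯ 1F ]×[ 0F ⋯ 0F ] ∷ [ 0F ⋯ 1F ]×[ 0F ⋯ 1F ] ∷ []) ∷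
  ([ 0F ⋯ 1F ]×[ 0F ⋯ 1F ] ∷ [ 0F ⋯ 2F ]×[ 1F ⋯ 1F ] ∷ [ 1F ⋯ 2F ]×[ 1F ⋯ 2F ] ∷ []) ∷
  ([ 0F ⋯ 0F ]×[ 0F ⋯ 2F ] ∷ [ 0F ⋯ 1F ]×[ 0F ⋯ 1F ] ∷ [ 0F ⋯ 2F ]×[ 0F ⋯ 0F ] ∷ []) ∷
  ([ 0F ⋯ 0F ]×[ 0F ⋯ 2F ] ∷ [ 0F ⋯ 1F ]×[ 0F ⋯ 1F ] ∷ [ 0F ⋯ 1F ]×[ 1F ⋯ 2F ] ∷ []) ∷
  ([ 0F ⋯ 1F ]×[ 0F ⋯ 1F ] ∷ [ 0F ⋯ 1F ]×[ 1F ⋯ 2F ] ∷ [ 1F ⋯ 2F ]×[ 0F ⋯ 2F ] ∷ []) ∷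
  []

-- Numbering the eight words turns a code into a subset of an eight-element set, so that a finite
-- search covers all 256 codes.
all-words : Vec (Subset 3) 8
all-words = s123 ∷ s12 ∷ s13 ∷ s1 ∷ s23 ∷ s2 ∷ s3 ∷ ∅ ∷ []

index : Subset 3 → Fin 8
index (true  ∷ true  ∷ true  ∷ []) = 0F
index (true  ∷ true  ∷ false ∷ []) = 1F
index (true  ∷ false ∷ true  ∷ []) = 2F
index (true  ∷ false ∷ false ∷ []) = 3F
index (false ∷ true  ∷ true  ∷ []) = 4F
index (false ∷ true  ∷ false ∷ []) = 5F
index (false ∷ false ∷ true  ∷ []) = 6F
index (false ∷ false ∷ false ∷ []) = 7F

lookup-index : ∀ σ → lookup all-words (index σ) ≡ σ
lookup-index (true  ∷ true  ∷ true  ∷ []) = ≡.refl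
lookup-index (true  ∷ true  ∷ false ∷ []) = ≡.refl
lookup-index (true  ∷ false ∷ true  ∷ []) = ≡.refl
lookup-index (true  ∷ false ∷ false ∷ []) = ≡.refl
lookup-index (false ∷ true  ∷ true  ∷ []) = ≡.refl
lookup-index (false ∷ true  ∷ false ∷ []) = ≡.refl
lookup-index (false ∷ false ∷ true  ∷ []) = ≡.refl
lookup-index (false ∷ false ∷ false ∷ []) = ≡.refl

encode : {𝒞 : Code 3} → Decidable 𝒞 → Subset 8
encode 𝒞? = Vec.map (λ σ → does (𝒞? σ)) all-words

decode : Subset 8 → Code 3
decode χ σ = index σ ∈ˢ χ

decode? : ∀ χ → Decidable (decode χ)
decode? χ σ = index σ ∈? χ

decode-encode : ∀ {𝒞 : Code 3} (𝒞? : Decidable 𝒞) → 𝒞 ≐ decode (encode 𝒞?)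
decode-encode {𝒞} 𝒞? = (λ {σ} → to (eq σ)) , (λ {σ} → from (eq σ))
  where
  eq : ∀ σ → 𝒞 σ ⇔ decode (encode 𝒞?) σ
  eq σ = Reflects⇒∈⇔ (encode 𝒞?) (≡.subst (Reflects (𝒞 σ)) (≡.sym lookup-encode) (proof (𝒞? σ)))
    where
    lookup-encode : lookup (encode 𝒞?) (index σ) ≡ does (𝒞? σ)
    lookup-encode = ≡.trans (Vec.lookup-map (index σ) (λ τ → does (𝒞? τ)) all-words)
      (≡.cong (λ τ → does (𝒞? τ)) (lookup-index σ))

encode-injective : ∀ {𝒞 𝒟 : Code 3} (𝒞? : Decidable 𝒞) (𝒟? : Decidable 𝒟) → encode 𝒞? ≡ encode 𝒟? → 𝒞 ≐ 𝒟
encode-injective 𝒞? 𝒟? eq =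
  (λ {σ} → proj₂ (decode-encode 𝒟?) ∘ ≡.subst (λ χ → decode χ σ) eq ∘ proj₁ (decode-encode 𝒞?)) ,
  (λ {σ} → proj₂ (decode-encode 𝒞?) ∘ ≡.subst (λ χ → decode χ σ) (≡.sym eq) ∘ proj₁ (decode-encode 𝒟?))

admissible-resp-≐ : ∀ {𝒞 𝒟 : Code 3} → 𝒞 ≐ 𝒟 → Admissible 𝒞 → Admissible 𝒟
admissible-resp-≐ (𝒞⊆𝒟 , 𝒟⊆𝒞) (c , c₁ , c₂ , c₃) = 𝒞⊆𝒟 c ,
  (λ d e → Sum.map 𝒞⊆𝒟 𝒞⊆𝒟 (c₁ (𝒟⊆𝒞 d) (𝒟⊆𝒞 e))) ,
  (λ d e → Sum.map 𝒞⊆𝒟 𝒞⊆𝒟 (c₂ (𝒟⊆𝒞 d) (𝒟⊆𝒞 e))) ,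
  (λ d e → Sum.map 𝒞⊆𝒟 𝒞⊆𝒟 (c₃ (𝒟⊆𝒞 d) (𝒟⊆𝒞 e)))

admissible? : ∀ {𝒞 : Code 3} → Decidable 𝒞 → Dec (Admissible 𝒞)
admissible? c? = c? ∅ ×-dec
  (c? s12 →-dec c? s13 →-dec (c? s123 ⊎-dec c? s1)) ×-dec
  (c? s12 →-dec c? s23 →-dec (c? s123 ⊎-dec c? s2)) ×-dec
  (c? s13 →-dec c? s23 →-dec (c? s123 ⊎-dec c? s3))

C₁? : Decidable C₁
C₁? = _∈ˡ? _

C₂? : Decidable C₂
C₂? = _∈ˡ? _

C₃? : Decidable C₃
C₃? = _∈ˡ? _

permuted? : ∀ π {𝒞 : Code 3} → Decidable 𝒞 → Decidable (π · 𝒞)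
permuted? π 𝒞? σ = 𝒞? _

box-code : Vec Box 3 → Subset 8
box-code Bs = encode (_∈ˡ? cell-words Bs)

permuted-code : {𝒞 : Code 3} → Decidable 𝒞 → Permutation′ 3 → Subset 8
permuted-code 𝒞? π = encode (permuted? π 𝒞?)

arrangements₆ : List (Vec Box 3)
arrangements₆ = concatMap orderings arrangements

-- `C₁` and `C₃` are fully symmetric and `C₂` is fixed by exchanging 2 and 3. These permutations
-- send 1 to 1, 2 and 3, so they produce every permuted copy.
transpositions : List (Permutation′ 3)
transpositions = Permutation.id ∷ transpose 0F 1F ∷ transpose 0F 2F ∷ []

open DecMembership (Vec.≡-dec {n = 8} Bool._≟_) using () renaming (_∈?_ to _∈ᶜ?_)

Classified : (bs cs ds es : List (Subset 8)) → Subset 8 → Set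
Classified bs cs ds es χ = χ ∈ˡ bs ⊎ χ ∈ˡ cs ⊎ χ ∈ˡ ds ⊎ χ ∈ˡ es

classified? : ∀ bs cs ds es → Decidable (Classified bs cs ds es)
classified? bs cs ds es χ = χ ∈ᶜ? bs ⊎-dec χ ∈ᶜ? cs ⊎-dec χ ∈ᶜ? ds ⊎-dec χ ∈ᶜ? es

unclassified? : ∀ bs cs ds es → Dec (∃[ χ ] Admissible (decode χ) × ¬ Classified bs cs ds es χ)
unclassified? bs cs ds es = anySubset? λ χ → admissible? (decode? χ) ×-dec ¬? (classified? bs cs ds es χ)

-- Decided by evaluation: the search through all codes finds no counterexample.
all-classified : ¬ (∃[ χ ] Admissible (decode χ) × ¬ Classified
  (List.map box-code arrangements₆) (List.map (permuted-code C₁?) transpositions)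
  (List.map (permuted-code C₂?) transpositions) (List.map (permuted-code C₃?) transpositions) χ)
all-classified = from-no (unclassified?
  (List.map box-code arrangements₆) (List.map (permuted-code C₁?) transpositions)
  (List.map (permuted-code C₂?) transpositions) (List.map (permuted-code C₃?) transpositions))

classified : ∀ bs cs ds es → ¬ (∃[ χ ] Admissible (decode χ) × ¬ Classified bs cs ds es χ) →
             ∀ χ → Admissible (decode χ) → Classified bs cs ds es χ
classified bs cs ds es none χ admissible =
  decidable-stable (classified? bs cs ds es χ) λ unclassified → none (χ , admissible , unclassified)

classification : ∀ {𝒞 : Code 3} → Decidable 𝒞 → Admissible 𝒞 →
  (∃[ Bs ] 𝒞 ≐ (_∈ˡ cell-words Bs)) ⊎ (𝒞 ∼ C₁) ⊎ (𝒞 ∼ C₂) ⊎ (𝒞 ∼ C₃)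
classification {𝒞} 𝒞? admissible =
  Sum.map boxes (Sum.map (permuted C₁?) (Sum.map (permuted C₂?) (permuted C₃?)))
    (classified _ _ _ _ all-classified (encode 𝒞?) (admissible-resp-≐ (decode-encode 𝒞?) admissible))
  where
  boxes : encode 𝒞? ∈ˡ List.map box-code arrangements₆ → ∃[ Bs ] 𝒞 ≐ (_∈ˡ cell-words Bs)
  boxes χ∈ = let Bs , _ , eq = ∈-map⁻ box-code {xs = arrangements₆} χ∈ in
    Bs , encode-injective 𝒞? (_∈ˡ? cell-words Bs) eq

  permuted : ∀ {𝒟} (𝒟? : Decidable 𝒟) → encode 𝒞? ∈ˡ List.map (permuted-code 𝒟?) transpositions → 𝒞 ∼ 𝒟
  permuted 𝒟? χ∈ = let π , _ , eq = ∈-map⁻ (permuted-code 𝒟?) {xs = transpositions} χ∈ in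
    π , encode-injective 𝒞? (permuted? π 𝒟?) eq

-- Invariants of codes under permutation, and the theorem.

∼-full-word : ∀ (𝒞 𝒟 : Code 3) → 𝒞 ∼ 𝒟 → 𝒞 s123 → 𝒟 s123
∼-full-word 𝒞 𝒟 (π , 𝒞⊆π𝒟 , _) c = ≡.subst 𝒟 (tabulate-cong λ i → lookup-replicate (π ⟨$⟩ʳ i) true) (𝒞⊆π𝒟 c)

-- The left side is a preimage under `π`, and `π` is injective.
permuted-singleton : ∀ {n} (π : Permutation′ n) j → tabulate (λ i → lookup ⁅ π ⟨$⟩ʳ j ⁆ (π ⟨$⟩ʳ i)) ≡ ⁅ j ⁆
permuted-singleton π j = ≡.trans (tabulate-cong λ i → det
    (∈⇔⇒Reflects ⁅ π ⟨$⟩ʳ j ⁆ (mk⇔ (from x∈⁅y⁆⇔x≡y ∘ ≡.cong (π ⟨$⟩ʳ_)) (Injection.injective (↔⇒↣ π) ∘ to x∈⁅y⁆⇔x≡y)))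
    (∈⇔⇒Reflects ⁅ j ⁆ (mk⇔ (from x∈⁅y⁆⇔x≡y) (to x∈⁅y⁆⇔x≡y))))
  (tabulate∘lookup ⁅ j ⁆)

∼-singleton : ∀ {n} (𝒞 𝒟 : Code n) j → 𝒞 ∼ 𝒟 → 𝒟 ⁅ j ⁆ → ∃[ i ] 𝒞 ⁅ i ⁆
∼-singleton 𝒞 𝒟 j (π , _ , π𝒟⊆𝒞) d = π ⟨$⟩ʳ j , π𝒟⊆𝒞 (≡.subst 𝒟 (≡.sym (permuted-singleton π j)) d)

-- Permutations preserve whether some singleton is a word; `C₂` has one and `C₁` has none.
C₁≁C₂ : ¬ (C₁ ∼ C₂)
C₁≁C₂ C₁∼C₂ =
  let i , i∈C₁ = ∼-singleton C₁ C₂ 0F C₁∼C₂ (there (there (there (there (here ≡.refl)))))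
  in no-singleton i i∈C₁
  where
  no-singleton : ∀ i → ¬ C₁ ⁅ i ⁆
  no-singleton = ∀₃ (from-no (C₁? s1)) (from-no (C₁? s2)) (from-no (C₁? s3))

-- Every permutation fixes 123, a word of `C₁` and of `C₂`, so its absence separates `C₃` from both.
-- It also rules out boxes for `C₃`.
s123∉C₃ : ¬ C₃ s123
s123∉C₃ = from-no (C₃? s123)

mainTheorem4 : ExcludedMiddle 0ℓ → (ℝ : CompleteOrderedField) →
    ((Convex ℝ C₁ × ¬ BoxConvex ℝ C₁) ×
    (Convex ℝ C₂ × ¬ BoxConvex ℝ C₂) ×
    (Convex ℝ C₃ × ¬ BoxConvex ℝ C₃)) ×
    ((¬ (C₁ ∼ C₂)) × (¬ (C₁ ∼ C₃)) × (¬ (C₂ ∼ C₃))) ×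
    ((𝒞 : Code 3) → Convex ℝ 𝒞 → ¬ BoxConvex ℝ 𝒞 →
    (𝒞 ∼ C₁) ⊎ (𝒞 ∼ C₂) ⊎ (𝒞 ∼ C₃))
mainTheorem4 em ℝ =
  ((C₁-convex , λ boxes → [ from-no (C₁? s2) , from-no (C₁? s3) ]′ (proj₂ (box-convex-with-pairs boxes
     (there (here ≡.refl)) (there (there (here ≡.refl))) (there (there (there (here ≡.refl))))))) ,
   (C₂-convex , λ boxes → [ from-no (C₂? s2) , from-no (C₂? s3) ]′ (proj₂ (box-convex-with-pairs boxes
     (there (here ≡.refl)) (there (there (here ≡.refl))) (there (there (there (here ≡.refl))))))) ,
   (C₃-convex , λ boxes → s123∉C₃ (proj₁ (box-convex-with-pairs boxes
     (here ≡.refl) (there (here ≡.refl)) (there (there (here ≡.refl))))))) ,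
  (C₁≁C₂ , (λ C₁∼C₃ → s123∉C₃ (∼-full-word C₁ C₃ C₁∼C₃ (here ≡.refl))) ,
   λ C₂∼C₃ → s123∉C₃ (∼-full-word C₂ C₃ C₂∼C₃ (here ≡.refl))) ,
  λ 𝒞 convex not-boxes →
    [ (λ (Bs , 𝒞≐) → contradiction (boxes-boxConvex Bs 𝒞≐) not-boxes) , id ]′
      -- Excluded middle decides membership in an arbitrary code, which makes it one of the
      -- enumerated ones.
      (classification {𝒞} (λ σ → em) (convex⇒admissible convex))
  where open Geometry em ℝ
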